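{- Let $n,m$ be integers with $0<m<n$ and let $T$ be a tree with bipartition $\{A,B\}$, where $0<|B|\leq |A|$. Then the following statements are equivalent: 1) $T \in \mathcal{T}_{\frac{n}{m}}$. 2) For every $x \in B$, $T$ has a fractional $[1,\frac{n}{m}]$-factor $h$ with values in $\{\frac{1}{m},\dots,\frac{m-1}{m},1\}$ such that $d^h(a)=1$ for every $a \in A$, $d^h(b)=\frac{n}{m}$ for every $b \in B\setminus\{x\}$, and $d^h(x)=\frac{n}{m}+|A|-\frac{n}{m}|B|$. 3) $|A| \leq \frac{n}{m} |B|$, and for every edge $e=xy \in E(T)$ we have $|V(T_e) \cap A|>\frac{n}{m} |V(T_e)\cap B|$, where $T_e$ is the component of $T-e$ that contains the unique vertex of $\{x,y\} \cap A$.
   Context: For a graph $H$ and $S\subset V(H)$, $H-S$ is the subgraph induced by $V(H)\setminus S$; $iso(H)$ is the number of isolated vertices of $H$; for $e\in E(H)$, $H-e$ is $H$ with edge $e$ deleted. For $h:E(H)\to[0,1]$ and $v\in V(H)$, $d^h(v)=\sum_{e\ni v}h(e)$. A fractional $[a,b]$-factor of $H$ is a function $h:E(H)\to[0,1]$ with $a\le d^h(v)\le b$ for all $v$. $\mathcal{T}_{\frac{n}{m}}$ is the set of trees $T$ such that (a) $iso(T-S)\le \frac{n}{m}|S|$ for all $S\subset V(T)$, and (b) for every $e\in E(T)$ there is a set $S^*\subset V(T)$ with $iso((T-e)-S^*)>\frac{n}{m}|S^*|$. -}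

module Defs where

open import Data.Nat as ℕ using (ℕ; zero; suc)
open import Data.Integer as ℤ using (+_)
open import Data.Rational as ℚ using (ℚ; 0ℚ)
open import Data.Bool using (Bool; true; false; if_then_else_; not; _∧_; _∨_)
open import Data.Fin using (Fin; zero; suc; _≟_)
open import Data.List using (List; []; _∷_; _++_; [_]; length)
open import Data.List.Relation.Unary.Linked using (Linked)
open import Data.List.Relation.Unary.Unique.Propositional using (Unique)
open import Data.Product using (Σ; _×_; ∃)
open import Relation.Binary.PropositionalEquality using (_≡_; _≢_)
open import Relation.Nullary.Decidable using (⌊_⌋)
open import Function using (_∘_)

-- k / m as a rational (m is always assumed positive where used;
-- the value for m = 0 is a junk default).
_/ₙ_ : ℕ → ℕ → ℚ
k /ₙ zero  = 0ℚ
k /ₙ suc m = (+ k) ℚ./ suc m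

⟦_⟧ : ℕ → ℚ
⟦ k ⟧ = k /ₙ 1

sumFin : ∀ {N} → (Fin N → ℚ) → ℚ
sumFin {zero}  f = 0ℚ
sumFin {suc N} f = f zero ℚ.+ sumFin (f ∘ suc)

count : ∀ {N} → (Fin N → Bool) → ℕ
count {zero}  f = 0
count {suc N} f = (if f zero then 1 else 0) ℕ.+ count (f ∘ suc)

allFin : ∀ {N} → (Fin N → Bool) → Bool
allFin {zero}  f = true
allFin {suc N} f = f zero ∧ allFin (f ∘ suc)

Graph : ℕ → Set
Graph N = Fin N → Fin N → Bool

Simple : ∀ {N} → Graph N → Set
Simple G = (∀ u v → G u v ≡ G v u) × (∀ u → G u u ≡ false)

data Reach {N} (G : Graph N) : Fin N → Fin N → Set where
  here  : ∀ {u} → Reach G u u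
  there : ∀ {u w v} → G u w ≡ true → Reach G w v → Reach G u v

Connected : ∀ {N} → Graph N → Set
Connected G = ∀ u v → Reach G u v

record Cycle {N} (G : Graph N) : Set where
  field
    v      : Fin N
    ws     : List (Fin N)
    long   : 2 ℕ.≤ length ws
    unique : Unique (v ∷ ws)
    linked : Linked (λ a b → G a b ≡ true) (v ∷ ws ++ [ v ])

Acyclic : ∀ {N} → Graph N → Set
Acyclic G = Cycle G → Data.Empty.⊥
  where import Data.Empty

Tree : ∀ {N} → Graph N → Set
Tree G = Simple G × Connected G × Acyclic G

deleteEdge : ∀ {N} → Graph N → Fin N → Fin N → Graph N
deleteEdge G x y u v =
  G u v ∧ not ((⌊ u ≟ x ⌋ ∧ ⌊ v ≟ y ⌋) ∨ (⌊ u ≟ y ⌋ ∧ ⌊ v ≟ x ⌋))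

-- iso(H - S): vertices outside S all of whose H-neighbours lie in S
iso : ∀ {N} → Graph N → (Fin N → Bool) → ℕ
iso G S = count (λ v → not (S v) ∧ allFin (λ u → not (G v u) ∨ S u))

InClassT : ∀ {N} → ℕ → ℕ → Graph N → Set
InClassT n m T =
  (∀ (S : Fin _ → Bool) → ⟦ iso T S ⟧ ℚ.≤ (n /ₙ m) ℚ.* ⟦ count S ⟧)
  × (∀ x y → T x y ≡ true →
       ∃ λ (S* : Fin _ → Bool) →
         ⟦ iso (deleteEdge T x y) S* ⟧ ℚ.> (n /ₙ m) ℚ.* ⟦ count S* ⟧)

-- Fractional factors.  An edge weighting of H is a function
-- h : Fin N → Fin N → ℚ, symmetric on edges; only values on edges matter.

degree : ∀ {N} → Graph N → (Fin N → Fin N → ℚ) → Fin N → ℚ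
degree G h v = sumFin (λ u → if G v u then h v u else 0ℚ)

IsEdgeWeighting : ∀ {N} → Graph N → (Fin N → Fin N → ℚ) → Set
IsEdgeWeighting G h = ∀ u v → G u v ≡ true → h u v ≡ h v u

FractionalFactor : ∀ {N} → Graph N → ℚ → ℚ → (Fin N → Fin N → ℚ) → Set
FractionalFactor G a b h =
  IsEdgeWeighting G h
  × (∀ u v → G u v ≡ true → (0ℚ ℚ.≤ h u v) × (h u v ℚ.≤ ⟦ 1 ⟧))
  × (∀ v → (a ℚ.≤ degree G h v) × (degree G h v ℚ.≤ b))

ValuesInSteps : ∀ {N} → ℕ → Graph N → (Fin N → Fin N → ℚ) → Set
ValuesInSteps m G h =
  ∀ u v → G u v ≡ true → Σ ℕ λ k → (1 ℕ.≤ k) × (k ℕ.≤ m) × (h u v ≡ k /ₙ m)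

Bipartition : ∀ {N} → Graph N → (Fin N → Bool) → Set
Bipartition G col = ∀ u v → G u v ≡ true → col u ≢ col v

isA isB : ∀ {N} → (Fin N → Bool) → Fin N → Bool
isA col v = col v
isB col v = not (col v)

Statement2 : ∀ {N} → ℕ → ℕ → Graph N → (Fin N → Bool) → Set
Statement2 n m T col =
  ∀ x → col x ≡ false →
    Σ (Fin _ → Fin _ → ℚ) λ h →
      FractionalFactor T ⟦ 1 ⟧ (n /ₙ m) h
      × ValuesInSteps m T h
      × (∀ a → col a ≡ true → degree T h a ≡ ⟦ 1 ⟧)
      × (∀ b → col b ≡ false → b ≢ x → degree T h b ≡ n /ₙ m)
      × (degree T h x ≡ (n /ₙ m) ℚ.+ ⟦ count (isA col) ⟧
                         ℚ.- (n /ₙ m) ℚ.* ⟦ count (isB col) ⟧)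

-- statement 3)  For an edge xy with x ∈ A, T_e is the component of T - e
-- containing x; it is given by its characteristic function C.
Statement3 : ∀ {N} → ℕ → ℕ → Graph N → (Fin N → Bool) → Set
Statement3 n m T col =
  (⟦ count (isA col) ⟧ ℚ.≤ (n /ₙ m) ℚ.* ⟦ count (isB col) ⟧)
  × (∀ x y → T x y ≡ true → col x ≡ true →
       ∀ (C : Fin _ → Bool) →
       (∀ v → (C v ≡ true → Reach (deleteEdge T x y) x v)
              × (Reach (deleteEdge T x y) x v → C v ≡ true)) →
       ⟦ count (λ v → C v ∧ isA col v) ⟧
         ℚ.> (n /ₙ m) ℚ.* ⟦ count (λ v → C v ∧ isB col v) ⟧)

{-# OPTIONS --safe #-}
-- After scaling by m all weights are integers.  A symmetric weighting h of the tree becomes, with the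
-- sign + on A and - on B, an antisymmetric flow, and a flow on a tree is determined by its divergence:
-- its value on the edge uv is the total divergence of the component of T - uv containing u.  This makes
-- 2) and 3) equivalent, except for the bound d(x) ≥ 1, which holds because a leaf a ∈ A (one exists
-- since |B| ≤ |A|) forces weight 1 on its edge.
-- Double counting shows that a graph with a fractional [1, n/m]-factor satisfies condition (a); with 3)
-- this gives 2) ⇒ 1).  For 1) ⇒ 2), condition (a) yields an integral factor by augmentation along tree
-- paths.  By (b) every factor of T is positive on every edge, so unit shifts along tree paths preserve
-- nonnegativity, and one can first push all degrees in A down to 1 and then concentrate the slack of B
-- in the single vertex x.
module Submission where

open import Defs
open import Data.Nat as ℕ using (ℕ; zero; suc)
open import Data.Integer as ℤ using (ℤ; +_; 0ℤ; 1ℤ; -1ℤ; _+_; _*_; -_; _-_; _⊔_)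
import Data.Integer.Properties as ℤₚ
open import Data.Integer.Tactic.RingSolver using (solve-∀)
open import Data.Rational as ℚ using (ℚ; 0ℚ; fromℚᵘ; toℚᵘ)
import Data.Rational.Properties as ℚₚ
open import Data.Rational.Unnormalised as ℚᵘ using (mkℚᵘ; *≡*; *≤*; *<*)
import Data.Rational.Unnormalised.Properties as ℚᵘₚ
open import Data.Bool using (Bool; true; false; if_then_else_; not; _∧_; _∨_)
import Data.Bool.Properties as Boolₚ
open import Data.Fin using (Fin; zero; suc; _≟_)
open import Data.Fin.Properties using (any?; all?)
open import Data.List using (List; []; _∷_; _++_; [_])
open import Data.List.Relation.Unary.Linked using (Linked; [-]; _∷_)
open import Data.List.Relation.Unary.Unique.Propositional using (Unique)
open import Data.List.Relation.Unary.AllPairs using ([]; _∷_)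
open import Data.List.Relation.Unary.All using ([])
open import Data.List.Relation.Unary.All.Properties using (¬Any⇒All¬)
open import Data.List.Relation.Unary.Any using (here; there)
open import Data.List.Membership.Propositional using (_∈_)
import Data.List.Membership.DecPropositional as DecMembership
open import Data.Product using (Σ; _×_; ∃; _,_; proj₁; proj₂)
open import Data.Sum using (_⊎_; inj₁; inj₂)
open import Data.Empty using (⊥; ⊥-elim)
open import Function using (_∘_)
open import Function.Bundles using (_⇔_; mk⇔)
open import Relation.Nullary using (¬_; Dec; yes; no; contradiction)
open import Relation.Nullary.Decidable using (⌊_⌋; ¬?; _×-dec_; _→-dec_)
open import Relation.Binary.PropositionalEquality hiding ([_])
open import Algebra.Properties.Semiring.Sum ℤₚ.+-*-semiring
  using (sum; sum-cong-≗; ∑-distrib-+; ∑-comm; *-distribˡ-sum; *-distribʳ-sum)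

-- The delicate point in 1) ⇒ 2) is the degree at `x`. Concentrating the slack lowers it, and it
-- must not fall below `m` while another vertex of B is still below `n`. A counting argument rules
-- this out once the final value `E` is known to satisfy `m ≤ E`, so this inequality has to be
-- obtained beforehand. The slack is therefore also concentrated at the neighbour `p` of a leaf in
-- A: there the leaf edge already carries `m` and a second edge is positive, so the room is visible
-- locally. Since `E` does not depend on `x`, the bound found at `p` serves every `x`.
--
-- No path is traversed when weights are shifted. The unit flow from `s` to `t` on an edge uv is a
-- difference of two indicators of the component of T - uv, and its divergence follows because
-- exactly one branch at a vertex contains any given other vertex. The upper bound 1 on the weights
-- is recovered at the end: every edge has an end in A, where the degree is 1.

module _ {N : ℕ} where

  -- Walks, simple paths and edge deletion

  data Path (G : Graph N) : Fin N → Fin N → List (Fin N) → Set where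
    nil  : ∀ {u} → Path G u u []
    cons : ∀ {u w v ws} → G u w ≡ true → Path G w v ws → Path G u v (w ∷ ws)

  UniquePath : Graph N → Fin N → Fin N → Set
  UniquePath G u v = ∃ λ ws → Path G u v ws × Unique (u ∷ ws)

  path-suffix : ∀ {G u w v ws} → Path G w v ws → Unique (w ∷ ws) → u ∈ (w ∷ ws) → UniquePath G u v
  path-suffix p          uniq       (here refl) = _ , p , uniq
  path-suffix (cons _ p) (_ ∷ uniq) (there u∈)  = path-suffix p uniq u∈

  reach⇒path : ∀ {G u v} → Reach G u v → UniquePath G u v
  reach⇒path here = [] , nil , [] ∷ []
  reach⇒path {u = u} (there {w = w} e r) with reach⇒path r
  ... | ws , p , uniq with u ∈? (w ∷ ws)
    where open DecMembership _≟_ using (_∈?_)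
  ... | yes u∈ = path-suffix p uniq u∈
  ... | no  u∉ = w ∷ ws , cons e p , ¬Any⇒All¬ (w ∷ ws) u∉ ∷ uniq

  path-linked : ∀ {G H : Graph N} {u v z ws} → (∀ {a b} → G a b ≡ true → H a b ≡ true) →
                H v z ≡ true → Path G u v ws → Linked (λ a b → H a b ≡ true) (u ∷ ws ++ [ z ])
  path-linked G⊆H e nil        = e ∷ [-]
  path-linked G⊆H e (cons d p) = G⊆H d ∷ path-linked G⊆H e p

  reach-trans : ∀ {G : Graph N} {u v w} → Reach G u v → Reach G v w → Reach G u w
  reach-trans here        s = s
  reach-trans (there e r) s = there e (reach-trans r s)

  reach-sym : ∀ {G : Graph N} → (∀ u v → G u v ≡ G v u) → ∀ {u v} → Reach G u v → Reach G v u
  reach-sym G-sym here        = here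
  reach-sym G-sym (there e r) = reach-trans (reach-sym G-sym r) (there (trans (G-sym _ _) e) here)

  deleteEdge-⊆ : ∀ (G : Graph N) {x y u v} → deleteEdge G x y u v ≡ true → G u v ≡ true
  deleteEdge-⊆ G {u = u} {v} e with G u v
  ... | true = refl

  deleteEdge-∌ : ∀ (G : Graph N) x y → deleteEdge G x y x y ≢ true
  deleteEdge-∌ G x y e with G x y | x ≟ x | y ≟ y
  deleteEdge-∌ G x y () | true | yes _ | yes _
  ... | true | yes _ | no y≢y = y≢y refl
  ... | true | no x≢x | _ = x≢x refl

  deleteEdge-cases : ∀ (G : Graph N) x y {u v} → G u v ≡ true →
    deleteEdge G x y u v ≡ true ⊎ (u ≡ x × v ≡ y) ⊎ (u ≡ y × v ≡ x)
  deleteEdge-cases G x y {u} {v} e rewrite e with u ≟ x | v ≟ y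
  ... | yes p | yes q = inj₂ (inj₁ (p , q))
  ... | yes p | no _ with u ≟ y | v ≟ x
  ...   | yes r | yes s = inj₂ (inj₂ (r , s))
  ...   | yes _ | no _  = inj₁ refl
  ...   | no _  | _     = inj₁ refl
  deleteEdge-cases G x y {u} {v} e | no _ | _ with u ≟ y | v ≟ x
  ...   | yes r | yes s = inj₂ (inj₂ (r , s))
  ...   | yes _ | no _  = inj₁ refl
  ...   | no _  | _     = inj₁ refl

  deleteEdge-swap : ∀ (G : Graph N) x y u v → deleteEdge G x y u v ≡ deleteEdge G y x u v
  deleteEdge-swap G x y u v =
    cong (λ b → G u v ∧ not b) (Boolₚ.∨-comm (⌊ u ≟ x ⌋ ∧ ⌊ v ≟ y ⌋) (⌊ u ≟ y ⌋ ∧ ⌊ v ≟ x ⌋))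

  deleteEdge-sym : ∀ (G : Graph N) → (∀ u v → G u v ≡ G v u) →
    ∀ x y u v → deleteEdge G x y u v ≡ deleteEdge G x y v u
  deleteEdge-sym G G-sym x y u v = cong₂ (λ a b → a ∧ not b) (G-sym u v)
    (trans (Boolₚ.∨-comm (⌊ u ≟ x ⌋ ∧ ⌊ v ≟ y ⌋) _)
           (cong₂ _∨_ (Boolₚ.∧-comm ⌊ u ≟ y ⌋ _) (Boolₚ.∧-comm ⌊ u ≟ x ⌋ _)))

  reach-⊆ : ∀ {G H : Graph N} → (∀ {a b} → G a b ≡ true → H a b ≡ true) →
            ∀ {u v} → Reach G u v → Reach H u v
  reach-⊆ G⊆H here        = here
  reach-⊆ G⊆H (there e r) = there (G⊆H e) (reach-⊆ G⊆H r)

  -- The two components of a tree minus an edge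

  module TreeStructure (T : Graph N) (T-tree : Tree T) where

    T-sym : ∀ u v → T u v ≡ T v u
    T-sym = proj₁ (proj₁ T-tree)

    adj-sym : ∀ {u v} → T u v ≡ true → T v u ≡ true
    adj-sym e = trans (T-sym _ _) e

    adj⇒≢ : ∀ {u v} → T u v ≡ true → u ≢ v
    adj⇒≢ {u} e refl with trans (sym e) (proj₂ (proj₁ T-tree) u)
    ... | ()

    del-reach-sym : ∀ {x y u v} → Reach (deleteEdge T x y) u v → Reach (deleteEdge T x y) v u
    del-reach-sym {x} {y} = reach-sym (deleteEdge-sym T T-sym x y)

    del-reach-swap : ∀ {x y u v} → Reach (deleteEdge T x y) u v → Reach (deleteEdge T y x) u v
    del-reach-swap {x} {y} = reach-⊆ (λ {a} {b} e → trans (sym (deleteEdge-swap T x y a b)) e)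

    -- A simple path from `x` to `y` avoiding the edge is closed by it to a cycle. Paths with fewer
    -- than two edges are too short for this; they would be a loop or the deleted edge itself.
    bridge : ∀ {x y} → T x y ≡ true → ¬ Reach (deleteEdge T x y) x y
    bridge {x} {y} e r with reach⇒path r
    ... | [] , nil , _ = adj⇒≢ e refl
    ... | _ ∷ [] , cons d nil , _ = deleteEdge-∌ T x y d
    ... | a ∷ b ∷ ws , p , uniq = proj₂ (proj₂ T-tree) record
      { v = x ; ws = a ∷ b ∷ ws ; long = ℕ.s≤s (ℕ.s≤s ℕ.z≤n) ; unique = uniq
      ; linked = path-linked (deleteEdge-⊆ T) (adj-sym e) p }

    -- The walk is cut after its last use of the edge; what remains starts at `x` or `y` and avoids
    -- it.
    reach-del : ∀ x y {u w} → Reach T u w →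
      Reach (deleteEdge T x y) u w ⊎ Reach (deleteEdge T x y) x w ⊎ Reach (deleteEdge T x y) y w
    reach-del x y here = inj₁ here
    reach-del x y (there e r) with reach-del x y r
    ... | inj₂ q = inj₂ q
    ... | inj₁ q with deleteEdge-cases T x y e
    ...   | inj₁ d = inj₁ (there d q)
    ...   | inj₂ (inj₁ (refl , refl)) = inj₂ (inj₂ q)
    ...   | inj₂ (inj₂ (refl , refl)) = inj₂ (inj₁ q)

    side : ∀ {x y} → T x y ≡ true → ∀ w →
      Reach (deleteEdge T x y) x w ⊎ Reach (deleteEdge T x y) y w
    side {x} {y} e w with reach-del x y (proj₁ (proj₂ T-tree) x w)
    ... | inj₁ r        = inj₁ r
    ... | inj₂ (inj₁ r) = inj₁ r
    ... | inj₂ (inj₂ r) = inj₂ r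

    -- `side` and `bridge` together decide reachability without a search. Non-adjacent pairs are
    -- answered negatively, so that sums over all vertices see only neighbours.
    σ? : ∀ u v w → Dec (T u v ≡ true × Reach (deleteEdge T u v) u w)
    σ? u v w with T u v Boolₚ.≟ true
    ... | no ¬e = no λ (e , _) → ¬e e
    ... | yes e with side e w
    ...   | inj₁ r = yes (e , r)
    ...   | inj₂ r = no λ (_ , s) → bridge e (reach-trans s (del-reach-sym r))

    abstract
      -- For an edge uv, σ u v is the characteristic function of the component of T - uv containing u.
      -- It is abstract because with-abstraction over T u v would otherwise be ill-typed.
      σ : Fin N → Fin N → Fin N → Bool
      σ u v w = ⌊ σ? u v w ⌋

      σ-elim : ∀ {u v w} → σ u v w ≡ true → T u v ≡ true × Reach (deleteEdge T u v) u w
      σ-elim {u} {v} {w} s with σ? u v w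
      ... | yes q = q

      reach⇒σ : ∀ {u v w} → T u v ≡ true → Reach (deleteEdge T u v) u w → σ u v w ≡ true
      reach⇒σ {u} {v} {w} e r with σ? u v w
      ... | yes _ = refl
      ... | no ¬q = contradiction (e , r) ¬q

    σ⇒adj : ∀ {u v w} → σ u v w ≡ true → T u v ≡ true
    σ⇒adj s = proj₁ (σ-elim s)

    σ⇒reach : ∀ {u v w} → σ u v w ≡ true → Reach (deleteEdge T u v) u w
    σ⇒reach s = proj₂ (σ-elim s)

    σ-compl : ∀ {u v} → T u v ≡ true → ∀ w → σ v u w ≡ not (σ u v w)
    σ-compl {u} {v} e w with σ u v w in eq
    ... | true = Boolₚ.¬-not (λ s → bridge e (reach-trans (σ⇒reach eq)
                   (del-reach-sym (del-reach-swap (σ⇒reach s)))))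
    ... | false with side e w
    ...   | inj₂ r = reach⇒σ (adj-sym e) (del-reach-swap r)
    ...   | inj₁ r with trans (sym eq) (reach⇒σ e r)
    ...     | ()

    σ-near : ∀ {u v} → T u v ≡ true → σ u v u ≡ true
    σ-near e = reach⇒σ e here

    σ-far : ∀ u v → σ u v v ≡ false
    σ-far u v = Boolₚ.¬-not (λ s → bridge (σ⇒adj s) (σ⇒reach s))

    σ-step : ∀ {u v s t} → T s t ≡ true → σ u v s ≡ true →
             σ u v t ≡ true ⊎ (s ≡ u × t ≡ v)
    σ-step {u} {v} {s} {t} e p with deleteEdge-cases T u v e
    ... | inj₁ d = inj₁ (reach⇒σ (σ⇒adj p) (reach-trans (σ⇒reach p) (there d here)))
    ... | inj₂ (inj₁ q) = inj₂ q
    ... | inj₂ (inj₂ (_ , refl)) = inj₁ (σ-near (σ⇒adj p))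

    -- The required `u` follows the last visit to `v` on a walk from `v` to `w`: the rest of the
    -- walk misses `v` and hence survives the deletion of any edge at `v`.
    branch-exists : ∀ {v w} → v ≢ w → ∃ λ u → σ u v w ≡ true
    branch-exists {v} {w} v≢w with go (proj₁ (proj₂ T-tree) v w)
      where
      go : ∀ {a} → Reach T a w → (∃ λ u → σ u v w ≡ true) ⊎ (a ≢ v × (∀ u → Reach (deleteEdge T u v) a w))
      go here = inj₂ (≢-sym v≢w , λ _ → here)
      go {a} (there {w = s} e r) with go r
      ... | inj₁ q = inj₁ q
      ... | inj₂ (s≢v , f) with a ≟ v
      ...   | yes refl = inj₁ (s , reach⇒σ (adj-sym e) (f s))
      ...   | no a≢v = inj₂ (a≢v , λ u → there (keep u) (f u))
        where
        keep : ∀ u → deleteEdge T u v a s ≡ true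
        keep u with deleteEdge-cases T u v e
        ... | inj₁ d = d
        ... | inj₂ (inj₁ (_ , s≡v)) = contradiction s≡v s≢v
        ... | inj₂ (inj₂ (a≡v , _)) = contradiction a≡v a≢v
    ... | inj₁ q = q
    ... | inj₂ (v≢v , _) = contradiction refl v≢v

    -- Two distinct branches at `v` meeting in `w` would give a detour from `u′` through `w` and `u`
    -- to `v`. The part between `u` and `w` never visits `v`, so the detour avoids the edge between
    -- `u′` and `v`, which is a bridge.
    branch-unique : ∀ {u u′ v w} → σ u v w ≡ true → σ u′ v w ≡ true → u ≡ u′
    branch-unique {u} {u′} {v} {w} p q with u ≟ u′
    ... | yes eq = eq
    ... | no u≢u′ = contradiction
        (reach-trans (σ⇒reach q) (del-reach-sym (there edge (avoid (σ⇒reach p) (bridge (σ⇒adj p))))))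
        (bridge (σ⇒adj q))
      where
      avoid : ∀ {a} → Reach (deleteEdge T u v) a w → ¬ Reach (deleteEdge T u v) a v →
              Reach (deleteEdge T u′ v) a w
      avoid here _ = here
      avoid {a} (there {w = s} e r) ¬v with deleteEdge-cases T u′ v (deleteEdge-⊆ T e)
      ... | inj₁ d = there d (avoid r (λ r′ → ¬v (there e r′)))
      ... | inj₂ (inj₁ (_ , refl)) = contradiction (there e here) ¬v
      ... | inj₂ (inj₂ (refl , _)) = contradiction here ¬v
      edge : deleteEdge T u′ v v u ≡ true
      edge with deleteEdge-cases T u′ v (adj-sym (σ⇒adj p))
      ... | inj₁ d = d
      ... | inj₂ (inj₁ (_ , u≡v)) = contradiction u≡v (adj⇒≢ (σ⇒adj p))
      ... | inj₂ (inj₂ (_ , u≡u′)) = contradiction u≡u′ u≢u′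

-- Integer sums, counting and descent

module IntegerSums where
  open import Data.Integer using (_≤_; _<_)

  𝟙 : Bool → ℤ
  𝟙 b = if b then 1ℤ else 0ℤ

  𝟙-nonNeg : ∀ b → 0ℤ ≤ 𝟙 b
  𝟙-nonNeg true  = ℤ.+≤+ ℕ.z≤n
  𝟙-nonNeg false = ℤ.+≤+ ℕ.z≤n

  sum-mono-≤ : ∀ {k} {f g : Fin k → ℤ} → (∀ i → f i ≤ g i) → sum f ≤ sum g
  sum-mono-≤ {zero}  f≤g = ℤₚ.≤-refl
  sum-mono-≤ {suc k} f≤g = ℤₚ.+-mono-≤ (f≤g zero) (sum-mono-≤ (f≤g ∘ suc))

  sum-mono-< : ∀ {k} {f g : Fin k → ℤ} → (∀ i → f i ≤ g i) → ∀ j → f j < g j → sum f < sum g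
  sum-mono-< f≤g zero    f<g = ℤₚ.+-mono-<-≤ f<g (sum-mono-≤ (f≤g ∘ suc))
  sum-mono-< f≤g (suc j) f<g = ℤₚ.+-mono-≤-< (f≤g zero) (sum-mono-< (f≤g ∘ suc) j f<g)

  sum-zero : ∀ {k} {f : Fin k → ℤ} → (∀ i → f i ≡ 0ℤ) → sum f ≡ 0ℤ
  sum-zero {zero}  f≡0 = refl
  sum-zero {suc k} f≡0 = cong₂ _+_ (f≡0 zero) (sum-zero (f≡0 ∘ suc))

  sum-nonNeg : ∀ {k} {f : Fin k → ℤ} → (∀ i → 0ℤ ≤ f i) → 0ℤ ≤ sum f
  sum-nonNeg {k} {f} 0≤f = subst (_≤ sum f) (sum-zero {k} (λ _ → refl)) (sum-mono-≤ 0≤f)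

  sum-single : ∀ {k} {f : Fin k → ℤ} j → (∀ i → i ≢ j → f i ≡ 0ℤ) → sum f ≡ f j
  sum-single {f = f} zero rest =
    trans (cong (λ z → f zero + z) (sum-zero (λ i → rest (suc i) λ ()))) (ℤₚ.+-identityʳ _)
  sum-single {f = f} (suc j) rest =
    trans (cong₂ _+_ (rest zero λ ()) (sum-single j λ i i≢j → rest (suc i) λ { refl → i≢j refl }))
          (ℤₚ.+-identityˡ _)

  restrict : ∀ {k} → Fin k → (Fin k → ℤ) → Fin k → ℤ
  restrict j f i = if ⌊ i ≟ j ⌋ then f i else 0ℤ

  restrict-≢ : ∀ {k} {i j : Fin k} f → i ≢ j → restrict j f i ≡ 0ℤ
  restrict-≢ {i = i} {j} f i≢j with i ≟ j
  ... | yes i≡j = contradiction i≡j i≢j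
  ... | no _    = refl

  sum-restrict : ∀ {k} j (f : Fin k → ℤ) → sum (restrict j f) ≡ f j
  sum-restrict j f = trans (sum-single j (λ i → restrict-≢ f)) on
    where
    on : restrict j f j ≡ f j
    on with j ≟ j
    ... | yes _  = refl
    ... | no j≢j = contradiction refl j≢j

  restrict-≤ : ∀ {k} {f : Fin k → ℤ} → (∀ i → 0ℤ ≤ f i) → ∀ j i → restrict j f i ≤ f i
  restrict-≤ 0≤f j i with i ≟ j
  ... | yes _ = ℤₚ.≤-refl
  ... | no _  = 0≤f i

  term-≤-sum : ∀ {k} {f : Fin k → ℤ} → (∀ i → 0ℤ ≤ f i) → ∀ j → f j ≤ sum f
  term-≤-sum {f = f} 0≤f j = subst (_≤ sum f) (sum-restrict j f) (sum-mono-≤ (restrict-≤ 0≤f j))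

  term-<-sum : ∀ {k} {f : Fin k → ℤ} → (∀ i → 0ℤ ≤ f i) → ∀ {j i} → i ≢ j → 0ℤ < f i → f j < sum f
  term-<-sum {f = f} 0≤f {j} {i} i≢j 0<fi = subst (_< sum f) (sum-restrict j f)
    (sum-mono-< (restrict-≤ 0≤f j) i (subst (_< f i) (sym (restrict-≢ f i≢j)) 0<fi))

  sum-neg : ∀ {k} (f : Fin k → ℤ) → sum (λ i → - f i) ≡ - sum f
  sum-neg f = begin
    sum (λ i → - f i)       ≡⟨ sum-cong-≗ (λ i → ℤₚ.-1*i≡-i (f i)) ⟨
    sum (λ i → -1ℤ * f i)   ≡⟨ *-distribˡ-sum -1ℤ f ⟨
    -1ℤ * sum f             ≡⟨ ℤₚ.-1*i≡-i (sum f) ⟩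
    - sum f                 ∎
    where open ≡-Reasoning

  sum-minus : ∀ {k} (f g : Fin k → ℤ) → sum (λ i → f i - g i) ≡ sum f - sum g
  sum-minus f g = trans (∑-distrib-+ f (λ i → - g i)) (cong (λ z → sum f + z) (sum-neg g))

  -- Exchanging the two summations turns the total into its own negative.
  sum-antisym : ∀ {k} (g : Fin k → Fin k → ℤ) → (∀ u v → g u v ≡ - g v u) →
                sum (λ u → sum (g u)) ≡ 0ℤ
  sum-antisym g anti = i≡-i⇒i≡0 _ (begin
    sum (λ u → sum (g u))
      ≡⟨ sum-cong-≗ (λ u → trans (sum-cong-≗ (anti u)) (sum-neg (λ v → g v u))) ⟩
    sum (λ u → - sum (λ v → g v u))     ≡⟨ sum-neg (λ u → sum (λ v → g v u)) ⟩
    - sum (λ u → sum (λ v → g v u))     ≡⟨ cong -_ (∑-comm g) ⟨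
    - sum (λ u → sum (g u))             ∎)
    where
    open ≡-Reasoning
    i≡-i⇒i≡0 : ∀ i → i ≡ - i → i ≡ 0ℤ
    i≡-i⇒i≡0 (+ zero) _ = refl

  count-sum : ∀ {k} (f : Fin k → Bool) → + count f ≡ sum (𝟙 ∘ f)
  count-sum {zero}  f = refl
  count-sum {suc k} f with f zero
  ... | true  = cong (λ z → 1ℤ + z) (count-sum (f ∘ suc))
  ... | false = trans (count-sum (f ∘ suc)) (sym (ℤₚ.+-identityˡ _))

  *-count : ∀ {k} c (f : Fin k → Bool) → c * + count f ≡ sum (λ i → c * 𝟙 (f i))
  *-count c f = trans (cong (c *_) (count-sum f)) (*-distribˡ-sum c (𝟙 ∘ f))

  allFin-elim : ∀ {k} {f : Fin k → Bool} → allFin f ≡ true → ∀ i → f i ≡ true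
  allFin-elim {suc k} {f} all i with f zero in eq
  allFin-elim {suc k} {f} all zero    | true = eq
  allFin-elim {suc k} {f} all (suc i) | true = allFin-elim all i

  allFin-intro : ∀ {k} {f : Fin k → Bool} → (∀ i → f i ≡ true) → allFin f ≡ true
  allFin-intro {zero}  all = refl
  allFin-intro {suc k} all = cong₂ _∧_ (all zero) (allFin-intro (all ∘ suc))

  -- Descent on a nonnegative integer potential. The shortage below `m`, the total degree and the
  -- degree at `x` serve as `Φ`.
  descend : ∀ {S D : Set} (Φ : S → ℤ) → (∀ s → 0ℤ ≤ Φ s) →
            (∀ s → D ⊎ ∃ λ s′ → Φ s′ < Φ s) → S → D
  descend {S} {D} Φ 0≤Φ step s₀ = go ℤ.∣ Φ s₀ ∣ s₀ (ℤₚ.≤-reflexive (sym (ℤₚ.0≤i⇒+∣i∣≡i (0≤Φ s₀))))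
    where
    go : ∀ k s → Φ s ≤ + k → D
    go k s Φ≤k with step s
    ... | inj₁ d = d
    go zero s Φ≤k | inj₂ (s′ , lt) = contradiction (ℤₚ.<-≤-trans lt Φ≤k) (ℤₚ.≤⇒≯ (0≤Φ s′))
    go (suc k) s Φ≤k | inj₂ (s′ , lt) = go k s′ (ℤₚ.i<j⇒i≤pred[j] (ℤₚ.<-≤-trans lt Φ≤k))

  <⇒+1≤ : ∀ {i j} → i < j → i + 1ℤ ≤ j
  <⇒+1≤ {i} {j} i<j = subst (_≤ j) (ℤₚ.+-comm 1ℤ i) (ℤₚ.i<j⇒suc[i]≤j i<j)

  <⇒≤-1 : ∀ {i j} → i < j → i ≤ j + -1ℤ
  <⇒≤-1 {i} {j} i<j = subst (i ≤_) (ℤₚ.+-comm -1ℤ j) (ℤₚ.i<j⇒i≤pred[j] i<j)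

  i-1<i : ∀ i → i + -1ℤ < i
  i-1<i i = subst (i + -1ℤ <_) (ℤₚ.+-identityʳ i) (ℤₚ.+-monoʳ-< i ℤ.-<+)

  i<i+1 : ∀ i → i < i + 1ℤ
  i<i+1 i = subst (_< i + 1ℤ) (ℤₚ.+-identityʳ i) (ℤₚ.+-monoʳ-< i (ℤ.+<+ (ℕ.s≤s ℕ.z≤n)))

  0<i-j⇒j<i : ∀ {i j} → 0ℤ < i - j → j < i
  0<i-j⇒j<i {i} {j} 0<i-j = subst₂ _<_ (ℤₚ.+-identityˡ j) (lemma i j) (ℤₚ.+-monoˡ-< j 0<i-j)
    where
    lemma : ∀ i j → i - j + j ≡ i
    lemma = solve-∀

  j<i⇒0<i-j : ∀ {i j} → j < i → 0ℤ < i - j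
  j<i⇒0<i-j {i} {j} j<i = subst (_< i - j) (ℤₚ.+-inverseʳ j) (ℤₚ.+-monoˡ-< (- j) j<i)

open IntegerSums

count-cong : ∀ {k} {f g : Fin k → Bool} → (∀ i → f i ≡ g i) → count f ≡ count g
count-cong {zero}  f≗g = refl
count-cong {suc k} f≗g = cong₂ (λ b c → (if b then 1 else 0) ℕ.+ c) (f≗g zero) (count-cong (f≗g ∘ suc))

count-positive : ∀ {k} (f : Fin k → Bool) → 0 ℕ.< count f → ∃ λ i → f i ≡ true
count-positive {suc k} f 0<c with f zero in eq
... | true = zero , eq
... | false with count-positive (f ∘ suc) 0<c
...   | i , fi = suc i , fi

≢-≢⇒≡ : ∀ {a b c : Bool} → a ≢ c → b ≢ c → a ≡ b
≢-≢⇒≡ p q = trans (Boolₚ.¬-not p) (sym (Boolₚ.¬-not q))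

-- Isolated vertices and integral weightings

module _ {N : ℕ} where
  open import Data.Integer using (_≤_; _<_)

  -- This is the predicate counted by `iso`, so `iso G S` is definitionally `count (isolated G S)`.
  isolated : Graph N → (Fin N → Bool) → Fin N → Bool
  isolated G S v = not (S v) ∧ allFin (λ u → not (G v u) ∨ S u)

  isolated-elim : ∀ G S {v u} → isolated G S v ≡ true → G v u ≡ true → S u ≡ true
  isolated-elim G S {v} {u} i e with not (S v)
  ... | true with allFin-elim i u
  ...   | c rewrite e = c

  isolated-intro : ∀ G S {v} → S v ≡ false → (∀ u → G v u ≡ true → S u ≡ true) → isolated G S v ≡ true
  isolated-intro G S {v} ¬Sv nbrs = cong₂ _∧_ (cong not ¬Sv) (allFin-intro go)
    where
    go : ∀ u → not (G v u) ∨ S u ≡ true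
    go u with G v u in eq
    ... | true  = nbrs u eq
    ... | false = refl

  iso-≥ : ∀ G S (X : Fin N → Bool) →
    (∀ v → X v ≡ true → S v ≡ false × (∀ u → G v u ≡ true → S u ≡ true)) →
    + count X ≤ + iso G S
  iso-≥ G S X iso-X = subst₂ _≤_ (sym (count-sum X)) (sym (count-sum (isolated G S))) (sum-mono-≤ le)
    where
    le : ∀ v → 𝟙 (X v) ≤ 𝟙 (isolated G S v)
    le v with X v in eq
    ... | false = 𝟙-nonNeg (isolated G S v)
    ... | true rewrite isolated-intro G S (proj₁ (iso-X v eq)) (proj₂ (iso-X v eq)) = ℤₚ.≤-refl

  deg : (Fin N → Fin N → ℤ) → Fin N → ℤ
  deg h v = sum (h v)

  -- Vanishing off the edges lets the degree be an unconditional sum over all vertices.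
  record Weighting (G : Graph N) (h : Fin N → Fin N → ℤ) : Set where
    field
      symmetric : ∀ u v → h u v ≡ h v u
      supported : ∀ u v → G u v ≡ false → h u v ≡ 0ℤ
      nonNeg    : ∀ u v → 0ℤ ≤ h u v

  -- Double counting the weight between S and the vertices isolated by S.
  iso-bound : ∀ {G h} a b → Weighting G h → (∀ v → a ≤ deg h v) → (∀ v → deg h v ≤ b) →
              ∀ S → a * + iso G S ≤ b * + count S
  iso-bound {G} {h} a b W a≤d d≤b S = begin
    a * + iso G S                                        ≡⟨ *-count a (isolated G S) ⟩
    sum (λ v → a * 𝟙 (isolated G S v))                   ≤⟨ sum-mono-≤ into-S ⟩
    sum (λ v → sum (λ u → 𝟙 (S u) * h v u))              ≡⟨ ∑-comm (λ v u → 𝟙 (S u) * h v u) ⟩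
    sum (λ u → sum (λ v → 𝟙 (S u) * h v u))
      ≡⟨ sum-cong-≗ (λ u → sum-cong-≗ (λ v → cong (𝟙 (S u) *_) (symmetric v u))) ⟩
    sum (λ u → sum (λ v → 𝟙 (S u) * h u v))              ≡⟨ sum-cong-≗ (λ u → *-distribˡ-sum (𝟙 (S u)) (h u)) ⟨
    sum (λ u → 𝟙 (S u) * deg h u)                        ≤⟨ sum-mono-≤ cap ⟩
    sum (λ u → b * 𝟙 (S u))                              ≡⟨ *-count b S ⟨
    b * + count S                                        ∎
    where
    open ℤₚ.≤-Reasoning
    open Weighting W
    cap : ∀ u → 𝟙 (S u) * deg h u ≤ b * 𝟙 (S u)
    cap u with S u
    ... | true  = subst₂ _≤_ (sym (ℤₚ.*-identityˡ _)) (sym (ℤₚ.*-identityʳ b)) (d≤b u)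
    ... | false = ℤₚ.≤-reflexive (sym (ℤₚ.*-zeroʳ b))
    𝟙*-nonNeg : ∀ c {i} → 0ℤ ≤ i → 0ℤ ≤ 𝟙 c * i
    𝟙*-nonNeg true  0≤i = subst (0ℤ ≤_) (sym (ℤₚ.*-identityˡ _)) 0≤i
    𝟙*-nonNeg false 0≤i = ℤₚ.≤-refl
    into-S : ∀ v → a * 𝟙 (isolated G S v) ≤ sum (λ u → 𝟙 (S u) * h v u)
    into-S v with isolated G S v in eq
    ... | false = subst (_≤ _) (sym (ℤₚ.*-zeroʳ a)) (sum-nonNeg (λ u → 𝟙*-nonNeg (S u) (nonNeg v u)))
    ... | true = subst₂ _≤_ (sym (ℤₚ.*-identityʳ a)) (sum-cong-≗ absorb) (a≤d v)
      where
      absorb : ∀ u → h v u ≡ 𝟙 (S u) * h v u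
      absorb u with G v u in e
      ... | true rewrite isolated-elim G S eq e = sym (ℤₚ.*-identityˡ _)
      ... | false rewrite supported v u e = sym (ℤₚ.*-zeroʳ (𝟙 (S u)))

-- Unit flows along tree paths

module Flows {N : ℕ} (T : Graph N) (T-tree : Tree T) (col : Fin N → Bool) (bip : Bipartition T col) where
  open TreeStructure T T-tree public
  open import Data.Integer using (_≤_; _<_)

  colour : ∀ v → col v ≡ true ⊎ col v ≡ false
  colour v with col v
  ... | true  = inj₁ refl
  ... | false = inj₂ refl

  A≢B : ∀ {a b} → col a ≡ true → col b ≡ false → a ≢ b
  A≢B a∈A b∈B refl = contradiction (trans (sym a∈A) b∈B) λ ()

  adj-A : ∀ {u v} → T u v ≡ true → col u ≡ true → col v ≡ false
  adj-A {u} {v} e u∈A = Boolₚ.¬-not λ v∈A → bip u v e (trans u∈A (sym v∈A))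

  adj-B : ∀ {u v} → T u v ≡ true → col u ≡ false → col v ≡ true
  adj-B {u} {v} e u∈B = Boolₚ.¬-not λ v∈B → bip u v e (trans u∈B (sym v∈B))

  sgn : Fin N → ℤ
  sgn v = if col v then 1ℤ else -1ℤ

  sgn-adj : ∀ {u v} → T u v ≡ true → sgn v ≡ - sgn u
  sgn-adj {u} {v} e with col u | col v | bip u v e
  ... | true  | false | _ = refl
  ... | false | true  | _ = refl
  ... | true  | true  | c≢c = contradiction refl c≢c
  ... | false | false | c≢c = contradiction refl c≢c

  σ-nonadj : ∀ {u v} w → T u v ≡ false → σ u v w ≡ false
  σ-nonadj w e = Boolₚ.¬-not λ s → contradiction (trans (sym e) (σ⇒adj s)) λ ()

  -- The components of the tree without `v` partition the other vertices, so exactly one neighbour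
  -- `u` has `w` on its side; the correction covers `w = v`, which lies on no such side. All
  -- divergences are computed from this count.
  σ-branches : ∀ v w → sum (λ u → 𝟙 (σ u v w)) ≡ 1ℤ - 𝟙 ⌊ v ≟ w ⌋
  σ-branches v w with v ≟ w
  ... | yes refl = sum-zero (λ u → cong 𝟙 (σ-far u v))
  ... | no v≢w with branch-exists v≢w
  ...   | u₀ , s₀ = trans
    (sum-single u₀ λ u u≢u₀ → cong 𝟙 (Boolₚ.¬-not λ s → u≢u₀ (branch-unique s s₀)))
    (cong 𝟙 s₀)

  𝟙-compl : ∀ {u v} → T u v ≡ true → ∀ w → 𝟙 (σ v u w) ≡ 1ℤ - 𝟙 (σ u v w)
  𝟙-compl {u} {v} e w rewrite σ-compl e w with σ u v w
  ... | true  = refl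
  ... | false = refl

  -- The unit flow along the tree path from s to t.
  path : Fin N → Fin N → Fin N → Fin N → ℤ
  path s t u v = 𝟙 (σ u v s) - 𝟙 (σ u v t)

  path-nonadj : ∀ s t {u v} → T u v ≡ false → path s t u v ≡ 0ℤ
  path-nonadj s t e rewrite σ-nonadj s e | σ-nonadj t e = refl

  path-antisym : ∀ s t u v → path s t v u ≡ - path s t u v
  path-antisym s t u v with T u v in e
  ... | false rewrite path-nonadj s t e | path-nonadj s t (trans (T-sym v u) e) = refl
  ... | true rewrite 𝟙-compl e s | 𝟙-compl e t = lemma (𝟙 (σ u v s)) (𝟙 (σ u v t))
    where
    lemma : ∀ a b → (1ℤ - a) - (1ℤ - b) ≡ - (a - b)
    lemma = solve-∀

  -- Antisymmetry trades outflow for inflow, because `σ-branches` sums over the near end of the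
  -- edges at `u`.
  path-divergence : ∀ s t u → sum (path s t u) ≡ 𝟙 ⌊ u ≟ s ⌋ - 𝟙 ⌊ u ≟ t ⌋
  path-divergence s t u = begin
    sum (path s t u)                  ≡⟨ sum-cong-≗ (λ v → path-antisym s t v u) ⟩
    sum (λ v → - path s t v u)        ≡⟨ sum-neg (λ v → path s t v u) ⟩
    - sum (λ v → path s t v u)        ≡⟨ cong -_ (sum-minus (λ v → 𝟙 (σ v u s)) (λ v → 𝟙 (σ v u t))) ⟩
    - (sum (λ v → 𝟙 (σ v u s)) - sum (λ v → 𝟙 (σ v u t)))
      ≡⟨ cong₂ (λ a b → - (a - b)) (σ-branches u s) (σ-branches u t) ⟩
    - ((1ℤ - 𝟙 ⌊ u ≟ s ⌋) - (1ℤ - 𝟙 ⌊ u ≟ t ⌋))   ≡⟨ lemma (𝟙 ⌊ u ≟ s ⌋) (𝟙 ⌊ u ≟ t ⌋) ⟩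
    𝟙 ⌊ u ≟ s ⌋ - 𝟙 ⌊ u ≟ t ⌋         ∎
    where
    open ≡-Reasoning
    lemma : ∀ a b → - ((1ℤ - a) - (1ℤ - b)) ≡ a - b
    lemma = solve-∀

  -- The factor `sgn u` makes the antisymmetric flow symmetric: the changes alternate in sign along
  -- the path, so inner degrees stay fixed and only the two ends change.
  shift : ℤ → Fin N → Fin N → (Fin N → Fin N → ℤ) → Fin N → Fin N → ℤ
  shift ε s t h u v = h u v + ε * sgn u * path s t u v

  shift-nonadj : ∀ ε s t {h} → Weighting T h → ∀ u v → T u v ≡ false → shift ε s t h u v ≡ 0ℤ
  shift-nonadj ε s t W u v e rewrite Weighting.supported W u v e | path-nonadj s t e =
    trans (ℤₚ.+-identityˡ _) (ℤₚ.*-zeroʳ (ε * sgn u))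

  shift-sym : ∀ ε s t {h} → Weighting T h → ∀ u v → shift ε s t h u v ≡ shift ε s t h v u
  shift-sym ε s t {h} W u v with T u v in e
  ... | false = trans (shift-nonadj ε s t W u v e)
                      (sym (shift-nonadj ε s t W v u (trans (T-sym v u) e)))
  ... | true rewrite path-antisym s t u v | sgn-adj e | Weighting.symmetric W u v =
    lemma (h v u) ε (sgn u) (path s t u v)
    where
    lemma : ∀ a ε b c → a + ε * b * c ≡ a + ε * - b * - c
    lemma = solve-∀

  shift-weighting : ∀ ε s t {h} → Weighting T h →
    (∀ u v → T u v ≡ true → 0ℤ ≤ shift ε s t h u v) → Weighting T (shift ε s t h)
  shift-weighting ε s t {h} W 0≤ = record
    { symmetric = shift-sym ε s t W ; supported = shift-nonadj ε s t W ; nonNeg = nonNeg′ }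
    where
    nonNeg′ : ∀ u v → 0ℤ ≤ shift ε s t h u v
    nonNeg′ u v with T u v in e
    ... | true  = 0≤ u v e
    ... | false = ℤₚ.≤-reflexive (sym (shift-nonadj ε s t W u v e))

  shift-deg : ∀ ε s t h u →
    deg (shift ε s t h) u ≡ deg h u + ε * sgn u * (𝟙 ⌊ u ≟ s ⌋ - 𝟙 ⌊ u ≟ t ⌋)
  shift-deg ε s t h u = trans (∑-distrib-+ (h u) (λ v → ε * sgn u * path s t u v))
    (cong (λ z → deg h u + z) (trans (sym (*-distribˡ-sum (ε * sgn u) (path s t u)))
                              (cong (ε * sgn u *_) (path-divergence s t u))))

  shift-deg-start : ∀ ε {s t} h → s ≢ t → deg (shift ε s t h) s ≡ deg h s + ε * sgn s
  shift-deg-start ε {s} {t} h s≢t with shift-deg ε s t h s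
  ... | eq with s ≟ s | s ≟ t
  ... | _ | yes s≡t = contradiction s≡t s≢t
  ... | no s≢s | _  = contradiction refl s≢s
  ... | yes _ | no _ = trans eq (cong (λ z → deg h s + z) (ℤₚ.*-identityʳ (ε * sgn s)))

  shift-deg-end : ∀ ε {s t} h → s ≢ t → deg (shift ε s t h) t ≡ deg h t - ε * sgn t
  shift-deg-end ε {s} {t} h s≢t with shift-deg ε s t h t
  ... | eq with t ≟ s | t ≟ t
  ... | yes t≡s | _  = contradiction (sym t≡s) s≢t
  ... | _ | no t≢t = contradiction refl t≢t
  ... | no _ | yes _ = trans eq (cong (λ z → deg h t + z) (lemma (ε * sgn t)))
    where
    lemma : ∀ a → a * -1ℤ ≡ - a
    lemma = solve-∀

  shift-deg-other : ∀ ε {s t u} h → u ≢ s → u ≢ t → deg (shift ε s t h) u ≡ deg h u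
  shift-deg-other ε {s} {t} {u} h u≢s u≢t with shift-deg ε s t h u
  ... | eq with u ≟ s | u ≟ t
  ... | yes u≡s | _  = contradiction u≡s u≢s
  ... | no _ | yes u≡t  = contradiction u≡t u≢t
  ... | no _ | no _ = trans eq (trans (cong (λ z → deg h u + z) (ℤₚ.*-zeroʳ (ε * sgn u))) (ℤₚ.+-identityʳ _))

-- Factors scaled by m, with degrees between m and n

module Factors {N : ℕ} (T : Graph N) (T-tree : Tree T) (col : Fin N → Bool) (bip : Bipartition T col)
         (m n : ℤ) (0<m : 0ℤ ℤ.< m) (m<n : m ℤ.< n) where
  open Flows T T-tree col bip
  open import Data.Integer using (_≤_; _<_)

  |A| |B| : ℤ
  |A| = + count (isA col)
  |B| = + count (isB col)

  sgn-A : ∀ {v} → col v ≡ true → sgn v ≡ 1ℤ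
  sgn-A eq rewrite eq = refl

  sgn-B : ∀ {v} → col v ≡ false → sgn v ≡ -1ℤ
  sgn-B eq rewrite eq = refl

  sgn*sgn-≡ : ∀ {u v} → col u ≡ col v → sgn u * sgn v ≡ 1ℤ
  sgn*sgn-≡ {u} {v} eq rewrite eq with col v
  ... | true  = refl
  ... | false = refl

  sgn*sgn-≢ : ∀ {u v} → col u ≢ col v → sgn u * sgn v ≡ -1ℤ
  sgn*sgn-≢ {u} {v} ne with col u | col v
  ... | true  | true  = contradiction refl ne
  ... | true  | false = refl
  ... | false | true  = refl
  ... | false | false = contradiction refl ne

  m*-mono : ∀ {i j} → i ≤ j → m * i ≤ m * j
  m*-mono = ℤₚ.*-monoˡ-≤-nonNeg m {{ℤ.nonNegative (ℤₚ.<⇒≤ 0<m)}}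

  record Factor (h : Fin N → Fin N → ℤ) : Set where
    field
      weighting : Weighting T h
      lower     : ∀ v → m ≤ deg h v
      upper     : ∀ v → deg h v ≤ n

  -- Existence of a factor by augmentation

  module Existence (iso-T : ∀ S → m * + iso T S ≤ n * + count S) where

    short : ℤ → ℤ
    short d = 0ℤ ⊔ (m - d)

    short-anti : ∀ {d d′} → d ≤ d′ → short d′ ≤ short d
    short-anti d≤d′ = ℤₚ.⊔-mono-≤ (ℤₚ.≤-refl {0ℤ}) (ℤₚ.+-monoʳ-≤ m (ℤₚ.neg-mono-≤ d≤d′))

    short-≥m : ∀ {d} d′ → m ≤ d → short d ≤ short d′
    short-≥m {d} d′ m≤d = subst (_≤ short d′) (sym (ℤₚ.i≥j⇒i⊔j≡i (ℤₚ.i≤j⇒i-j≤0 m≤d))) (ℤₚ.i≤i⊔j 0ℤ (m - d′))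

    short-<m : ∀ {d} → d < m → short (d + 1ℤ) < short d
    short-<m {d} d<m = subst₂ _<_ (sym (ℤₚ.i≤j⇒i⊔j≡j 0≤m-d-1)) (sym (ℤₚ.i≤j⇒i⊔j≡j (ℤₚ.i≤j⇒0≤j-i (ℤₚ.<⇒≤ d<m))))
                         (ℤₚ.+-monoʳ-< m (ℤₚ.neg-mono-< (i<i+1 d)))
      where
      0≤m-d-1 : 0ℤ ≤ m - (d + 1ℤ)
      0≤m-d-1 = ℤₚ.i≤j⇒0≤j-i (<⇒+1≤ d<m)

    record Partial : Set where
      field
        h         : Fin N → Fin N → ℤ
        weighting : Weighting T h
        upper     : ∀ v → deg h v ≤ n

    shortage : Partial → ℤ
    shortage s = sum (λ v → short (deg (Partial.h s) v))

    module Augment (s : Partial) (v : Fin N) (dv<m : deg (Partial.h s) v < m) where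
      open Partial s
      open Weighting weighting

      -- On the path from v to z, the shift decreases h exactly on the edges leading into the class of v.
      Augmentable : Fin N → Set
      Augmentable z = ∀ u w → col u ≡ col v → σ w u v ≡ true → σ w u z ≡ false → 0ℤ < h u w

      augmentable? : ∀ z → Dec (Augmentable z)
      augmentable? z = all? λ u → all? λ w → (col u Boolₚ.≟ col v) →-dec
        ((σ w u v Boolₚ.≟ true) →-dec ((σ w u z Boolₚ.≟ false) →-dec (0ℤ ℤₚ.<? h u w)))

      -- By `σ-step`, the only edge that can newly separate `v` from the endpoint is the one between
      -- `z` and `z′`; its weight matters only when it is entered towards the class of `v`.
      augmentable-step : ∀ {z z′} → Augmentable z → T z z′ ≡ true →
        (col z′ ≡ col v → 0ℤ < h z′ z) → Augmentable z′
      augmentable-step {z} {z′} az e pos u w u~v near far with σ w u z in eq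
      ... | false = az u w u~v near eq
      ... | true with σ-step e eq
      ...   | inj₁ q = contradiction (trans (sym q) far) λ ()
      ...   | inj₂ (refl , refl) = pos u~v

      shifted-nonNeg-≡ : ∀ {z} → Augmentable z → ∀ u w → T u w ≡ true → col u ≡ col v →
        0ℤ ≤ shift (sgn v) v z h u w
      shifted-nonNeg-≡ {z} az u w e u~v rewrite sgn*sgn-≡ {v} {u} (sym u~v)
        with σ u w v in near | σ u w z in far
      ... | true  | true  = ℤₚ.+-mono-≤ (nonNeg u w) (ℤ.+≤+ ℕ.z≤n)
      ... | true  | false = ℤₚ.+-mono-≤ (nonNeg u w) (ℤ.+≤+ ℕ.z≤n)
      ... | false | false = ℤₚ.+-mono-≤ (nonNeg u w) (ℤ.+≤+ ℕ.z≤n)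
      -- The only case in which the weight drops, and exactly the one where `Augmentable` guarantees
      -- a unit to take away.
      ... | false | true  = <⇒≤-1 (az u w u~v (trans (σ-compl e v) (cong not near))
                                              (trans (σ-compl e z) (cong not far)))

      shifted-nonNeg : ∀ {z} → Augmentable z → ∀ u w → T u w ≡ true → 0ℤ ≤ shift (sgn v) v z h u w
      shifted-nonNeg {z} az u w e with col u Boolₚ.≟ col v
      ... | yes u~v = shifted-nonNeg-≡ az u w e u~v
      ... | no u≁v = subst (0ℤ ≤_) (sym (shift-sym (sgn v) v z weighting u w))
        (shifted-nonNeg-≡ az w u (adj-sym e) (≢-≢⇒≡ (≢-sym (bip u w e)) (≢-sym u≁v)))

      -- The gain is at `v`, whose degree rises by one. At the other end an odd path adds a unit and
      -- an even path removes one, hence the product of signs and the two conditions on the end.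
      augment : ∀ {z} → v ≢ z → Augmentable z →
        deg h z - sgn v * sgn z ≤ n → short (deg h z - sgn v * sgn z) ≤ short (deg h z) →
        ∃ λ s′ → shortage s′ < shortage s
      augment {z} v≢z az ≤n short-≤ = s′ , sum-mono-< le v lt
        where
        h′ = shift (sgn v) v z h
        at-v : deg h′ v ≡ deg h v + 1ℤ
        at-v = trans (shift-deg-start (sgn v) h v≢z) (cong (λ c → deg h v + c) (sgn*sgn-≡ {v} {v} refl))
        at-z : deg h′ z ≡ deg h z - sgn v * sgn z
        at-z = shift-deg-end (sgn v) h v≢z
        upper′ : ∀ u → deg h′ u ≤ n
        upper′ u with u ≟ v | u ≟ z
        ... | yes refl | _ = subst (_≤ n) (sym at-v) (ℤₚ.≤-trans (<⇒+1≤ dv<m) (ℤₚ.<⇒≤ m<n))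
        ... | no _ | yes refl = subst (_≤ n) (sym at-z) ≤n
        ... | no u≢v | no u≢z = subst (_≤ n) (sym (shift-deg-other (sgn v) h u≢v u≢z)) (upper u)
        s′ : Partial
        s′ = record { h = h′ ; weighting = shift-weighting (sgn v) v z weighting (shifted-nonNeg az)
                    ; upper = upper′ }
        lt : short (deg h′ v) < short (deg h v)
        lt = subst (λ d → short d < short (deg h v)) (sym at-v) (short-<m dv<m)
        le : ∀ u → short (deg h′ u) ≤ short (deg h u)
        le u with u ≟ v | u ≟ z
        ... | yes refl | _ = ℤₚ.<⇒≤ lt
        ... | no _ | yes refl = subst (λ d → short d ≤ short (deg h z)) (sym at-z) short-≤
        ... | no u≢v | no u≢z = ℤₚ.≤-reflexive (cong short (shift-deg-other (sgn v) h u≢v u≢z))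

      raise : ∀ {y} → col v ≢ col y → Augmentable y → deg h y < n → ∃ λ s′ → shortage s′ < shortage s
      raise {y} v≁y ay dy<n = augment (v≁y ∘ cong col) ay
        (subst (_≤ n) (sym +1) (<⇒+1≤ dy<n))
        (short-anti (subst (deg h y ≤_) (sym +1) (ℤₚ.<⇒≤ (i<i+1 _))))
        where
        +1 : deg h y - sgn v * sgn y ≡ deg h y + 1ℤ
        +1 = cong (λ c → deg h y - c) (sgn*sgn-≢ {v} {y} v≁y)

      lower-end : ∀ {x} → col v ≡ col x → Augmentable x → m < deg h x → ∃ λ s′ → shortage s′ < shortage s
      lower-end {x} v~x ax m<dx = augment (λ { refl → ℤₚ.<-asym dv<m m<dx }) ax
        (subst (_≤ n) (sym -1′) (ℤₚ.≤-trans (ℤₚ.<⇒≤ (i-1<i _)) (upper x)))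
        (short-≥m _ (subst (m ≤_) (sym -1′) (<⇒≤-1 m<dx)))
        where
        -1′ : deg h x - sgn v * sgn x ≡ deg h x + -1ℤ
        -1′ = cong (λ c → deg h x - c) (sgn*sgn-≡ {v} {x} v~x)

      -- The vertices reachable by alternating paths, as in bipartite matching: `X` in the class of
      -- `v`, `Y` in the opposite class.
      X Y : Fin N → Bool
      X z = ⌊ augmentable? z ×-dec (col v Boolₚ.≟ col z) ⌋
      Y z = ⌊ augmentable? z ×-dec ¬? (col v Boolₚ.≟ col z) ⌋

      X-elim : ∀ {z} → X z ≡ true → Augmentable z × col v ≡ col z
      X-elim {z} eq with augmentable? z ×-dec (col v Boolₚ.≟ col z)
      ... | yes q = q

      X-intro : ∀ {z} → Augmentable z → col v ≡ col z → X z ≡ true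
      X-intro {z} az v~z with augmentable? z ×-dec (col v Boolₚ.≟ col z)
      ... | yes _ = refl
      ... | no ¬q = contradiction (az , v~z) ¬q

      Y-elim : ∀ {z} → Y z ≡ true → Augmentable z × col v ≢ col z
      Y-elim {z} eq with augmentable? z ×-dec ¬? (col v Boolₚ.≟ col z)
      ... | yes q = q

      Y-intro : ∀ {z} → Augmentable z → col v ≢ col z → Y z ≡ true
      Y-intro {z} az v~z with augmentable? z ×-dec ¬? (col v Boolₚ.≟ col z)
      ... | yes _ = refl
      ... | no ¬q = contradiction (az , v~z) ¬q

      -- If no augmentation is possible, then the set Y violates the isolation bound, because it
      -- isolates X while all its weight, n on each vertex, goes into X.
      saturated : (∀ y → Y y ≡ true → n ≤ deg h y) → (∀ x → X x ≡ true → deg h x ≤ m) → ⊥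
      saturated Y-full X-low = ℤₚ.<-irrefl refl (begin-strict
        n * + count Y                                ≡⟨ *-count n Y ⟩
        sum (λ y → n * 𝟙 (Y y))                      ≤⟨ sum-mono-≤ full ⟩
        sum (λ y → 𝟙 (Y y) * deg h y)                ≡⟨ sum-cong-≗ (λ y → *-distribˡ-sum (𝟙 (Y y)) (h y)) ⟩
        sum (λ y → sum (λ x → 𝟙 (Y y) * h y x))      ≤⟨ sum-mono-≤ (λ y → sum-mono-≤ (λ x → into-X y x)) ⟩
        sum (λ y → sum (λ x → 𝟙 (X x) * h x y))      ≡⟨ ∑-comm (λ y x → 𝟙 (X x) * h x y) ⟩
        sum (λ x → sum (λ y → 𝟙 (X x) * h x y))      ≡⟨ sum-cong-≗ (λ x → *-distribˡ-sum (𝟙 (X x)) (h x)) ⟨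
        sum (λ x → 𝟙 (X x) * deg h x)                <⟨ sum-mono-< low v low-v ⟩
        sum (λ x → m * 𝟙 (X x))                      ≡⟨ *-count m X ⟨
        m * + count X                                ≤⟨ m*-mono (iso-≥ T Y X X-isolated) ⟩
        m * + iso T Y                                ≤⟨ iso-T Y ⟩
        n * + count Y                                ∎)
        where
        open ℤₚ.≤-Reasoning
        full : ∀ y → n * 𝟙 (Y y) ≤ 𝟙 (Y y) * deg h y
        full y with Y y in eq
        ... | true  = subst₂ _≤_ (sym (ℤₚ.*-identityʳ n)) (sym (ℤₚ.*-identityˡ _)) (Y-full y eq)
        ... | false = ℤₚ.≤-reflexive (ℤₚ.*-zeroʳ n)
        low : ∀ x → 𝟙 (X x) * deg h x ≤ m * 𝟙 (X x)
        low x with X x in eq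
        ... | true  = subst₂ _≤_ (sym (ℤₚ.*-identityˡ _)) (sym (ℤₚ.*-identityʳ m)) (X-low x eq)
        ... | false = ℤₚ.≤-reflexive (sym (ℤₚ.*-zeroʳ m))
        v∈X : X v ≡ true
        v∈X = X-intro (λ u w u~v near far → contradiction (trans (sym near) far) λ ()) refl
        low-v : 𝟙 (X v) * deg h v < m * 𝟙 (X v)
        low-v rewrite v∈X = subst₂ _<_ (sym (ℤₚ.*-identityˡ _)) (sym (ℤₚ.*-identityʳ m)) dv<m
        -- Returning from `Y` to the class of `v` requires a positive edge, so edges from `Y` to
        -- vertices outside `X` carry no weight.
        Y⇒X : ∀ {y x} → Y y ≡ true → T y x ≡ true → 0ℤ < h x y → X x ≡ true
        Y⇒X {y} {x} y∈Y e 0<h = X-intro (augmentable-step (proj₁ (Y-elim y∈Y)) e (λ _ → 0<h))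
          (≢-≢⇒≡ (proj₂ (Y-elim y∈Y)) (≢-sym (bip y x e)))
        into-X : ∀ y x → 𝟙 (Y y) * h y x ≤ 𝟙 (X x) * h x y
        into-X y x rewrite symmetric y x with X x in x∈X | Y y in y∈Y
        ... | true  | true  = ℤₚ.≤-refl
        ... | false | false = ℤₚ.≤-refl
        ... | true  | false = subst (0ℤ ≤_) (sym (ℤₚ.*-identityˡ _)) (nonNeg x y)
        ... | false | true with T y x in e
        ...   | false rewrite supported x y (trans (T-sym x y) e) = ℤₚ.≤-refl
        ...   | true = subst (_≤ 0ℤ) (sym (ℤₚ.*-identityˡ _))
                         (ℤₚ.≮⇒≥ λ 0<h → contradiction (trans (sym (Y⇒X y∈Y e 0<h)) x∈X) λ ())
        -- Leaving the class of `v` imposes no condition on the weight, so every neighbour of `X`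
        -- lies in `Y`.
        X-isolated : ∀ x → X x ≡ true → Y x ≡ false × (∀ u → T x u ≡ true → Y u ≡ true)
        X-isolated x x∈X with X-elim x∈X
        ... | ax , v~x = Boolₚ.¬-not (λ x∈Y → proj₂ (Y-elim x∈Y) v~x) , λ u e →
          let v≁u = λ v~u → bip x u e (trans (sym v~x) v~u) in
          Y-intro (augmentable-step ax e (λ u~v → contradiction (sym u~v) v≁u)) v≁u

      progress : ∃ λ s′ → shortage s′ < shortage s
      progress with any? (λ y → (Y y Boolₚ.≟ true) ×-dec (deg h y ℤₚ.<? n))
      ... | yes (y , y∈Y , dy<n) = raise (proj₂ (Y-elim y∈Y)) (proj₁ (Y-elim y∈Y)) dy<n
      ... | no Y-full with any? (λ x → (X x Boolₚ.≟ true) ×-dec (m ℤₚ.<? deg h x))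
      ...   | yes (x , x∈X , m<dx) = lower-end (proj₂ (X-elim x∈X)) (proj₁ (X-elim x∈X)) m<dx
      ...   | no X-low = ⊥-elim (saturated
              (λ y y∈Y → ℤₚ.≮⇒≥ λ lt → Y-full (y , y∈Y , lt))
              (λ x x∈X → ℤₚ.≮⇒≥ λ lt → X-low (x , x∈X , lt)))

    factor-exists : ∃ Factor
    factor-exists = descend shortage (λ s → sum-nonNeg (λ v → ℤₚ.i≤i⊔j 0ℤ (m - deg (Partial.h s) v))) step empty
      where
      step : ∀ s → ∃ Factor ⊎ ∃ λ s′ → shortage s′ < shortage s
      step s with any? (λ v → deg (Partial.h s) v ℤₚ.<? m)
      ... | yes (v , dv<m) = inj₂ (Augment.progress s v dv<m)
      ... | no ¬short = inj₁ (Partial.h s , record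
        { weighting = Partial.weighting s ; upper = Partial.upper s
        ; lower = λ v → ℤₚ.≮⇒≥ λ lt → ¬short (v , lt) })
      empty : Partial
      empty = record
        { h = λ _ _ → 0ℤ
        ; weighting = record { symmetric = λ _ _ → refl ; supported = λ _ _ _ → refl ; nonNeg = λ _ _ → ℤₚ.≤-refl }
        ; upper = λ v → ℤₚ.≤-trans (ℤₚ.≤-reflexive (sum-zero {N} λ _ → refl)) (ℤₚ.<⇒≤ (ℤₚ.<-trans 0<m m<n)) }

  -- Signed degree sums: both colour classes carry the same total degree

  signed-deg : ∀ {h} → Weighting T h → sum (λ v → sgn v * deg h v) ≡ 0ℤ
  signed-deg {h} W = trans (sum-cong-≗ (λ v → *-distribˡ-sum (sgn v) (h v)))
                           (sum-antisym (λ v u → sgn v * h v u) anti)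
    where
    open Weighting W
    anti : ∀ u v → sgn u * h u v ≡ - (sgn v * h v u)
    anti u v with T u v in e
    ... | false rewrite supported u v e | supported v u (trans (T-sym v u) e) =
      trans (ℤₚ.*-zeroʳ (sgn u)) (cong -_ (sym (ℤₚ.*-zeroʳ (sgn v))))
    ... | true rewrite symmetric u v | sgn-adj e = lemma (sgn u) (h v u)
      where
      lemma : ∀ a b → a * b ≡ - (- a * b)
      lemma = solve-∀

  signed-const : ∀ p q → sum (λ v → if col v then p else - q) ≡ p * |A| - q * |B|
  signed-const p q = trans (sum-cong-≗ pointwise) (trans (sum-minus (λ v → p * 𝟙 (isA col v)) (λ v → q * 𝟙 (isB col v)))
    (sym (cong₂ _-_ (*-count p (isA col)) (*-count q (isB col)))))
    where
    lemma₁ : ∀ p q → p ≡ p * 1ℤ - q * 0ℤ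
    lemma₁ = solve-∀
    lemma₂ : ∀ p q → - q ≡ p * 0ℤ - q * 1ℤ
    lemma₂ = solve-∀
    pointwise : ∀ v → (if col v then p else - q) ≡ p * 𝟙 (isA col v) - q * 𝟙 (isB col v)
    pointwise v with col v
    ... | true  = lemma₁ p q
    ... | false = lemma₂ p q

  -- m times the degree that 2) prescribes at x.
  E : ℤ
  E = n + m * |A| - n * |B|

  -- `positive` encodes the lower bound 1/m on the values. The upper bound 1 follows from `deg-A`,
  -- since every edge has an end in A.
  record Statement2ℤ (x : Fin N) : Set where
    field
      h        : Fin N → Fin N → ℤ
      factor   : Factor h
      positive : ∀ u v → T u v ≡ true → 0ℤ < h u v
      deg-A    : ∀ a → col a ≡ true → deg h a ≡ m
      deg-B    : ∀ b → col b ≡ false → b ≢ x → deg h b ≡ n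
      deg-x    : deg h x ≡ E

  -- Deviation from degree `m` on A and `n` on B, signed so that the actual degrees cancel in the
  -- sum: its total is the same for every weighting.
  defect : (Fin N → Fin N → ℤ) → Fin N → ℤ
  defect h v = (if col v then m else - n) - sgn v * deg h v

  sum-defect : ∀ {h} → Weighting T h → sum (defect h) ≡ m * |A| - n * |B|
  sum-defect {h} W = trans (sum-minus _ (λ v → sgn v * deg h v))
    (trans (cong₂ _-_ (signed-const m n) (signed-deg W)) (ℤₚ.+-identityʳ _))

  defect-A : ∀ {h a} → col a ≡ true → deg h a ≡ m → defect h a ≡ 0ℤ
  defect-A eq da rewrite eq | da = lemma m
    where
    lemma : ∀ m → m - 1ℤ * m ≡ 0ℤ
    lemma = solve-∀

  defect-B : ∀ {h b} → col b ≡ false → defect h b ≡ deg h b - n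
  defect-B {h} {b} eq rewrite eq = lemma n (deg h b)
    where
    lemma : ∀ n d → - n - -1ℤ * d ≡ d - n
    lemma = solve-∀

  record Tight (h : Fin N → Fin N → ℤ) : Set where
    field
      factor : Factor h
      deg-A  : ∀ a → col a ≡ true → deg h a ≡ m
    open Factor factor public

  -- All defect sits at `x`, so it equals the total, which is independent of `h`. This is where the
  -- formula for `E` comes from.
  tight-deg-x : ∀ {h x} → Tight h → col x ≡ false →
    (∀ b → col b ≡ false → b ≢ x → deg h b ≡ n) → deg h x ≡ E
  tight-deg-x {h} {x} t x∈B deg-B = begin
    deg h x                          ≡⟨ lemma (deg h x) n ⟩
    n + (deg h x - n)                ≡⟨ cong (λ z → n + z) (defect-B {h} x∈B) ⟨
    n + defect h x                   ≡⟨ cong (λ z → n + z) (sum-single x elsewhere) ⟨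
    n + sum (defect h)               ≡⟨ cong (λ z → n + z) (sum-defect (Tight.weighting t)) ⟩
    n + (m * |A| - n * |B|)          ≡⟨ ℤₚ.+-assoc n (m * |A|) (- (n * |B|)) ⟨
    E                                ∎
    where
    open ≡-Reasoning
    lemma : ∀ d n → d ≡ n + (d - n)
    lemma = solve-∀
    elsewhere : ∀ v → v ≢ x → defect h v ≡ 0ℤ
    elsewhere v v≢x with colour v
    ... | inj₁ v∈A = defect-A {h} v∈A (Tight.deg-A t v v∈A)
    ... | inj₂ v∈B = trans (defect-B {h} v∈B) (ℤₚ.i≡j⇒i-j≡0 (deg-B v v∈B v≢x))

  -- With the degree of `x` at most `m`, the defect at `x` is at most `m - n`. The vertex `b` adds a
  -- negative defect and no vertex a positive one, so the total drops below `m - n`, whereas it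
  -- equals `E - n`.
  tight-room : ∀ {x} → col x ≡ false → m ≤ E →
    ∀ {h} → Tight h → ∀ b → col b ≡ false → b ≢ x → deg h b < n → m < deg h x
  tight-room {x} x∈B m≤E {h} t b b∈B b≢x db<n = ℤₚ.≰⇒> λ dx≤m → ℤₚ.<-irrefl refl (begin-strict
    m * |A| - n * |B|                       ≡⟨ sum-defect (Tight.weighting t) ⟨
    sum (defect h)                          <⟨ sum-mono-< (le dx≤m) b lt ⟩
    sum (restrict x (λ _ → m - n))          ≡⟨ sum-restrict x (λ _ → m - n) ⟩
    m - n                                   ≤⟨ ℤₚ.+-monoˡ-≤ (- n) m≤E ⟩
    E - n                                   ≡⟨ lemma n (m * |A|) (n * |B|) ⟩
    m * |A| - n * |B|                       ∎)
    where
    open ℤₚ.≤-Reasoning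
    lemma : ∀ n a b → (n + a - b) - n ≡ a - b
    lemma = solve-∀
    lt : defect h b < restrict x (λ _ → m - n) b
    lt rewrite restrict-≢ {j = x} (λ _ → m - n) b≢x | defect-B {h} b∈B =
      subst (deg h b - n <_) (ℤₚ.+-inverseʳ n) (ℤₚ.+-monoˡ-< (- n) db<n)
    le : deg h x ≤ m → ∀ v → defect h v ≤ restrict x (λ _ → m - n) v
    le dx≤m v with v ≟ x
    ... | yes refl = subst (_≤ m - n) (sym (defect-B {h} x∈B)) (ℤₚ.+-monoˡ-≤ (- n) dx≤m)
    ... | no v≢x with colour v
    ...   | inj₁ v∈A = ℤₚ.≤-reflexive (defect-A {h} v∈A (Tight.deg-A t v v∈A))
    ...   | inj₂ v∈B = subst (_≤ 0ℤ) (sym (defect-B {h} v∈B)) (ℤₚ.i≤j⇒i-j≤0 (Tight.upper t v))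

  -- Redistributing degrees in a critical tree

  module Critical
    (iso-T : ∀ S → m * + iso T S ≤ n * + count S)
    (iso-T-e : ∀ x y → T x y ≡ true → ∃ λ S → n * + count S < m * + iso (deleteEdge T x y) S)
    (|B|≤|A| : |B| ≤ |A|)
    where

    -- A factor vanishing on an edge is also a factor of the tree without it, and `iso-bound` then
    -- excludes the violating set provided by (b).
    factor-positive : ∀ {h} → Factor h → ∀ u v → T u v ≡ true → 0ℤ < h u v
    factor-positive {h} f u v e = ℤₚ.≰⇒> λ h≤0 →
      let S , lt = iso-T-e u v e in
      ℤₚ.<⇒≱ lt (iso-bound m n (avoiding (ℤₚ.≤-antisym h≤0 (nonNeg u v))) lower upper S)
      where
      open Factor f
      open Weighting weighting
      avoiding : h u v ≡ 0ℤ → Weighting (deleteEdge T u v) h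
      avoiding h≡0 = record { symmetric = symmetric ; supported = supported′ ; nonNeg = nonNeg }
        where
        supported′ : ∀ a b → deleteEdge T u v a b ≡ false → h a b ≡ 0ℤ
        supported′ a b d with T a b in ab
        ... | false = supported a b ab
        ... | true with deleteEdge-cases T u v ab
        ...   | inj₁ d′ = contradiction (trans (sym d′) (trans (cong (_∧ _) ab) d)) λ ()
        ...   | inj₂ (inj₁ (refl , refl)) = h≡0
        ...   | inj₂ (inj₂ (refl , refl)) = trans (symmetric v u) h≡0

    -- A shift changes each edge by at most one and each edge has at least one unit, so
    -- nonnegativity needs no inspection of the path. With the coefficient -1, a move from A to B
    -- lowers both ends, and a move inside B raises `s` and lowers `t`.
    move : ∀ s t {h} → s ≢ t → Factor h →
      m ≤ deg h s - sgn s → deg h s - sgn s ≤ n →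
      m ≤ deg h t + sgn t → deg h t + sgn t ≤ n → Factor (shift -1ℤ s t h)
    move s t {h} s≢t f ls us lt ut = record
      { weighting = shift-weighting -1ℤ s t weighting nonNeg′ ; lower = lower′ ; upper = upper′ }
      where
      open Factor f
      at-s : deg (shift -1ℤ s t h) s ≡ deg h s - sgn s
      at-s = trans (shift-deg-start -1ℤ h s≢t) (lemma (deg h s) (sgn s))
        where
        lemma : ∀ d σ → d + -1ℤ * σ ≡ d - σ
        lemma = solve-∀
      at-t : deg (shift -1ℤ s t h) t ≡ deg h t + sgn t
      at-t = trans (shift-deg-end -1ℤ h s≢t) (lemma (deg h t) (sgn t))
        where
        lemma : ∀ d σ → d - -1ℤ * σ ≡ d + σ
        lemma = solve-∀
      lower′ : ∀ v → m ≤ deg (shift -1ℤ s t h) v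
      lower′ v with v ≟ s | v ≟ t
      ... | yes refl | _ = subst (m ≤_) (sym at-s) ls
      ... | no _ | yes refl = subst (m ≤_) (sym at-t) lt
      ... | no v≢s | no v≢t = subst (m ≤_) (sym (shift-deg-other -1ℤ h v≢s v≢t)) (lower v)
      upper′ : ∀ v → deg (shift -1ℤ s t h) v ≤ n
      upper′ v with v ≟ s | v ≟ t
      ... | yes refl | _ = subst (_≤ n) (sym at-s) us
      ... | no _ | yes refl = subst (_≤ n) (sym at-t) ut
      ... | no v≢s | no v≢t = subst (_≤ n) (sym (shift-deg-other -1ℤ h v≢s v≢t)) (upper v)
      step≥-1 : ∀ u v → -1ℤ ≤ -1ℤ * sgn u * path s t u v
      step≥-1 u v with col u | σ u v s | σ u v t
      ... | true  | true  | true  = ℤ.-≤+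
      ... | true  | true  | false = ℤ.-≤- ℕ.z≤n
      ... | true  | false | true  = ℤ.-≤+
      ... | true  | false | false = ℤ.-≤+
      ... | false | true  | true  = ℤ.-≤+
      ... | false | true  | false = ℤ.-≤+
      ... | false | false | true  = ℤ.-≤- ℕ.z≤n
      ... | false | false | false = ℤ.-≤+
      nonNeg′ : ∀ u v → T u v ≡ true → 0ℤ ≤ shift -1ℤ s t h u v
      nonNeg′ u v e = ℤₚ.≤-trans (<⇒≤-1 (factor-positive f u v e)) (ℤₚ.+-monoʳ-≤ (h u v) (step≥-1 u v))

    -- While A is not tight, |B| ≤ |A| leaves slack in B as well, so a vertex of each can be lowered.
    tight-exists : ∃ Factor → ∃ Tight
    tight-exists = descend total 0≤total step
      where
      total : ∃ Factor → ℤ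
      total (h , _) = sum (deg h)
      0≤total : ∀ f → 0ℤ ≤ total f
      0≤total (h , f) = sum-nonNeg λ v → ℤₚ.≤-trans (ℤₚ.<⇒≤ 0<m) (Factor.lower f v)
      step : ∀ f → ∃ Tight ⊎ ∃ λ f′ → total f′ < total f
      step (h , f) with any? (λ a → (col a Boolₚ.≟ true) ×-dec (m ℤₚ.<? deg h a))
      ... | no tight = inj₁ (h , record { factor = f ; deg-A = λ a a∈A →
              ℤₚ.≤-antisym (ℤₚ.≮⇒≥ λ lt → tight (a , a∈A , lt)) (Factor.lower f a) })
      ... | yes (a , a∈A , m<da) with any? (λ b → (col b Boolₚ.≟ false) ×-dec (m ℤₚ.<? deg h b))
      -- With B at degree `m` throughout and `a` above it, A would have strictly more total degree
      -- than B.
      ...   | no B-low = ⊥-elim (ℤₚ.<-irrefl refl (begin-strict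
        0ℤ                                             ≤⟨ ℤₚ.i≤j⇒0≤j-i (m*-mono |B|≤|A|) ⟩
        m * |A| - m * |B|                              ≡⟨ signed-const m m ⟨
        sum (λ v → if col v then m else - m)           <⟨ sum-mono-< le a lt ⟩
        sum (λ v → sgn v * deg h v)                    ≡⟨ signed-deg (Factor.weighting f) ⟩
        0ℤ                                             ∎))
        where
        open ℤₚ.≤-Reasoning
        lt : (if col a then m else - m) < sgn a * deg h a
        lt rewrite a∈A = subst (m <_) (sym (ℤₚ.*-identityˡ (deg h a))) m<da
        le : ∀ v → (if col v then m else - m) ≤ sgn v * deg h v
        le v with col v in eq
        ... | true = subst (m ≤_) (sym (ℤₚ.*-identityˡ (deg h v))) (Factor.lower f v)
        ... | false = subst (- m ≤_) (sym (ℤₚ.-1*i≡-i (deg h v)))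
                        (ℤₚ.neg-mono-≤ (ℤₚ.≮⇒≥ λ m<dv → B-low (v , eq , m<dv)))
      ...   | yes (b , b∈B , m<db) = inj₂ ((shift -1ℤ a b h , f′) , sum-mono-< le a lt)
        where
        a≢b : a ≢ b
        a≢b = A≢B a∈A b∈B
        f′ : Factor (shift -1ℤ a b h)
        f′ = move a b a≢b f
          (subst (λ c → m ≤ deg h a - c) (sym (sgn-A a∈A)) (<⇒≤-1 m<da))
          (subst (λ c → deg h a - c ≤ n) (sym (sgn-A a∈A)) (ℤₚ.≤-trans (ℤₚ.<⇒≤ (i-1<i _)) (Factor.upper f a)))
          (subst (λ c → m ≤ deg h b + c) (sym (sgn-B b∈B)) (<⇒≤-1 m<db))
          (subst (λ c → deg h b + c ≤ n) (sym (sgn-B b∈B)) (ℤₚ.≤-trans (ℤₚ.<⇒≤ (i-1<i _)) (Factor.upper f b)))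
        lt : deg (shift -1ℤ a b h) a < deg h a
        lt rewrite shift-deg-start -1ℤ h a≢b | sgn-A a∈A = i-1<i (deg h a)
        le : ∀ v → deg (shift -1ℤ a b h) v ≤ deg h v
        le v with v ≟ a | v ≟ b
        ... | yes refl | _ = ℤₚ.<⇒≤ lt
        ... | no v≢a | no v≢b = ℤₚ.≤-reflexive (shift-deg-other -1ℤ h v≢a v≢b)
        ... | no _ | yes refl rewrite shift-deg-end -1ℤ h a≢b | sgn-B b∈B = ℤₚ.<⇒≤ (i-1<i (deg h b))

    -- Each step carries a unit from `x` to a vertex of B below `n`, leaving A alone. That `x` can
    -- spare the unit is the hypothesis `room`, supplied by `leaf-room` at the neighbour of a leaf
    -- and by `tight-room` at an arbitrary `x`.
    concentrate : ∀ {x} → col x ≡ false →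
      (∀ {h} → Tight h → ∀ b → col b ≡ false → b ≢ x → deg h b < n → m < deg h x) →
      ∃ Tight → Statement2ℤ x
    concentrate {x} x∈B room = descend (λ (h , _) → deg h x)
        (λ (h , t) → ℤₚ.≤-trans (ℤₚ.<⇒≤ 0<m) (Tight.lower t x)) step
      where
      step : ∀ s → Statement2ℤ x ⊎ ∃ λ s′ → deg (proj₁ {B = Tight} s′) x < deg (proj₁ {B = Tight} s) x
      step (h , t) with any? (λ b → (col b Boolₚ.≟ false) ×-dec (¬? (b ≟ x) ×-dec (deg h b ℤₚ.<? n)))
      ... | no full = inj₁ record
        { h = h ; factor = Tight.factor t ; positive = factor-positive (Tight.factor t)
        ; deg-A = Tight.deg-A t ; deg-B = deg-B ; deg-x = tight-deg-x t x∈B deg-B }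
        where
        deg-B : ∀ b → col b ≡ false → b ≢ x → deg h b ≡ n
        deg-B b b∈B b≢x = ℤₚ.≤-antisym (Tight.upper t b) (ℤₚ.≮⇒≥ λ lt → full (b , b∈B , b≢x , lt))
      ... | yes (b , b∈B , b≢x , db<n) = inj₂ ((shift -1ℤ b x h , t′) , lt)
        where
        m<dx : m < deg h x
        m<dx = room t b b∈B b≢x db<n
        f′ : Factor (shift -1ℤ b x h)
        f′ = move b x b≢x (Tight.factor t)
          (subst (λ c → m ≤ deg h b - c) (sym (sgn-B b∈B)) (ℤₚ.≤-trans (Tight.lower t b) (ℤₚ.<⇒≤ (i<i+1 _))))
          (subst (λ c → deg h b - c ≤ n) (sym (sgn-B b∈B)) (<⇒+1≤ db<n))
          (subst (λ c → m ≤ deg h x + c) (sym (sgn-B x∈B)) (<⇒≤-1 m<dx))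
          (subst (λ c → deg h x + c ≤ n) (sym (sgn-B x∈B)) (ℤₚ.≤-trans (ℤₚ.<⇒≤ (i-1<i _)) (Tight.upper t x)))
        t′ : Tight (shift -1ℤ b x h)
        t′ = record { factor = f′ ; deg-A = λ a a∈A → trans
          (shift-deg-other -1ℤ h (A≢B a∈A b∈B)
                                 (A≢B a∈A x∈B))
          (Tight.deg-A t a a∈A) }
        lt : deg (shift -1ℤ b x h) x < deg h x
        lt rewrite shift-deg-end -1ℤ h b≢x | sgn-B x∈B = i-1<i (deg h x)

  -- Leaves in A and the resulting room at their neighbours

  Leaf : Fin N → Fin N → Set
  Leaf a p = col a ≡ true × T a p ≡ true × (∀ b → T a b ≡ true → b ≡ p)

  -- Rooting the tree at r ∈ B, the children of the vertices of A are distinct elements of B ∖ {r}.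
  leaf-exists : |B| ≤ |A| → ∀ r → col r ≡ false → ∃ λ a → ∃ λ p → Leaf a p
  leaf-exists |B|≤|A| r r∈B
    with any? (λ a → (col a Boolₚ.≟ true) ×-dec all? (λ b → σ a b r Boolₚ.≟ false))
  -- `σ a b r` says that `b` is a child of `a`. Without children, every neighbour has the root on
  -- its own side, and only one branch at `a` contains the root.
  ... | yes (a , a∈A , childless) = a , p , a∈A , adj-sym (σ⇒adj p-side) , λ b e →
          branch-unique (trans (σ-compl e r) (cong not (childless b))) p-side
    where
    parent : ∃ λ p → σ p a r ≡ true
    parent = branch-exists (A≢B a∈A r∈B)
    p = proj₁ parent
    p-side = proj₂ parent
  ... | no none = contradiction |B|≤|A| (ℤₚ.<⇒≱ (begin-strict
    |A|                                                             ≡⟨ count-sum (isA col) ⟩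
    sum (λ a → 𝟙 (isA col a))                                       ≤⟨ sum-mono-≤ has-child ⟩
    sum (λ a → sum (λ b → 𝟙 (isA col a ∧ σ a b r)))
      ≡⟨ ∑-comm (λ a b → 𝟙 (isA col a ∧ σ a b r)) ⟩
    sum (λ b → sum (λ a → 𝟙 (isA col a ∧ σ a b r)))                 <⟨ sum-mono-< one-parent r root ⟩
    sum (λ b → 𝟙 (isB col b))                                       ≡⟨ count-sum (isB col) ⟨
    |B|                                                             ∎))
    where
    open ℤₚ.≤-Reasoning
    has-child : ∀ a → 𝟙 (isA col a) ≤ sum (λ b → 𝟙 (isA col a ∧ σ a b r))
    has-child a with colour a
    ... | inj₂ a∈B rewrite a∈B = sum-nonNeg {N} (λ _ → ℤₚ.≤-refl)
    ... | inj₁ a∈A rewrite a∈A with any? (λ b → σ a b r Boolₚ.≟ true)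
    ...   | yes (b , s) = subst (_≤ sum (λ b → 𝟙 (σ a b r))) (cong 𝟙 s) (term-≤-sum (λ b → 𝟙-nonNeg (σ a b r)) b)
    ...   | no childless = contradiction (a , a∈A , λ b → Boolₚ.¬-not λ s → childless (b , s)) none
    ∧-≤ : ∀ a b → 𝟙 (isA col a ∧ σ a b r) ≤ 𝟙 (σ a b r)
    ∧-≤ a b with col a
    ... | true  = ℤₚ.≤-refl
    ... | false = 𝟙-nonNeg (σ a b r)
    one-parent : ∀ b → sum (λ a → 𝟙 (isA col a ∧ σ a b r)) ≤ 𝟙 (isB col b)
    one-parent b with colour b
    ... | inj₁ b∈A rewrite b∈A = ℤₚ.≤-reflexive (sum-zero no-edge)
      where
      no-edge : ∀ a → 𝟙 (col a ∧ σ a b r) ≡ 0ℤ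
      no-edge a with col a in a∈A | σ a b r in s
      ... | false | _     = refl
      ... | true  | false = refl
      ... | true  | true  = contradiction (trans a∈A (sym b∈A)) (bip a b (σ⇒adj s))
    ... | inj₂ b∈B rewrite b∈B = ℤₚ.≤-trans (sum-mono-≤ (λ a → ∧-≤ a b))
      (subst (_≤ 1ℤ) (sym (σ-branches b r)) (1-𝟙≤1 ⌊ b ≟ r ⌋))
      where
      1-𝟙≤1 : ∀ c → 1ℤ - 𝟙 c ≤ 1ℤ
      1-𝟙≤1 true  = ℤ.+≤+ ℕ.z≤n
      1-𝟙≤1 false = ℤₚ.≤-refl
    root : sum (λ a → 𝟙 (isA col a ∧ σ a r r)) < 𝟙 (isB col r)
    root rewrite r∈B = ℤₚ.≤-<-trans (ℤₚ.≤-reflexive (sum-zero zero-term)) (ℤ.+<+ (ℕ.s≤s ℕ.z≤n))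
      where
      zero-term : ∀ a → 𝟙 (isA col a ∧ σ a r r) ≡ 0ℤ
      zero-term a rewrite σ-far a r = cong 𝟙 (Boolₚ.∧-zeroʳ (col a))

  leaf-weight : ∀ {h a p} → Weighting T h → Leaf a p → h a p ≡ deg h a
  leaf-weight {h} {a} {p} W (_ , e , only) = sym (sum-single p elsewhere)
    where
    elsewhere : ∀ u → u ≢ p → h a u ≡ 0ℤ
    elsewhere u u≢p with T a u in au
    ... | true  = contradiction (only u au) u≢p
    ... | false = Weighting.supported W a u au

  leaf-deg-≤ : ∀ {h a p} → Weighting T h → Leaf a p → deg h a ≤ deg h p
  leaf-deg-≤ {h} {a} {p} W l = subst (_≤ deg h p) (trans (Weighting.symmetric W p a) (leaf-weight W l))
    (term-≤-sum (Weighting.nonNeg W p) a)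

  -- The branch at `p` containing `b` cannot start with the leaf `a`, because from `a` every other
  -- vertex is reached through `p`.
  second-neighbour : ∀ {a p b} → Leaf a p → col b ≡ false → b ≢ p → ∃ λ u → T p u ≡ true × u ≢ a
  second-neighbour {a} {p} {b} (a∈A , e , only) b∈B b≢p with branch-exists (≢-sym b≢p)
  ... | u , s = u , adj-sym (σ⇒adj s) , u≢a
    where
    u≢a : u ≢ a
    u≢a refl with branch-exists {a} {b} (A≢B a∈A b∈B)
    ... | w , s′ with only w (adj-sym (σ⇒adj s′))
    ...   | refl = contradiction (trans (sym s′) (trans (σ-compl e b) (cong not s))) λ ()

  module _
    (iso-T : ∀ S → m * + iso T S ≤ n * + count S)
    (iso-T-e : ∀ x y → T x y ≡ true → ∃ λ S → n * + count S < m * + iso (deleteEdge T x y) S)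
    (|B|≤|A| : |B| ≤ |A|)
    where
    open Critical iso-T iso-T-e |B|≤|A|

    -- The leaf puts its whole degree `m` on the edge to `p`, and the edge from `p` towards `b` adds
    -- a positive amount.
    leaf-room : ∀ {a p} → Leaf a p →
      ∀ {h} → Tight h → ∀ b → col b ≡ false → b ≢ p → deg h b < n → m < deg h p
    leaf-room {a} {p} l@(a∈A , e , _) {h} t b b∈B b≢p _ = begin-strict
      m                                    ≡⟨ Tight.deg-A t a a∈A ⟨
      deg h a                              ≡⟨ leaf-weight W l ⟨
      h a p                                ≡⟨ Weighting.symmetric W a p ⟩
      h p a
        <⟨ term-<-sum (Weighting.nonNeg W p) u≢a (factor-positive (Tight.factor t) p u pu) ⟩
      deg h p                              ∎
      where
      open ℤₚ.≤-Reasoning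
      W = Tight.weighting t
      other = second-neighbour l b∈B b≢p
      u = proj₁ other
      pu = proj₁ (proj₂ other)
      u≢a = proj₂ (proj₂ other)

    1⇒2 : ∀ x → col x ≡ false → Statement2ℤ x
    1⇒2 x x∈B with leaf-exists |B|≤|A| x x∈B
    ... | a , p , l = concentrate x∈B (tight-room x∈B m≤E) tight
      where
      tight : ∃ Tight
      tight = tight-exists (Existence.factor-exists iso-T)
      p∈B : col p ≡ false
      p∈B = adj-A (proj₁ (proj₂ l)) (proj₁ l)
      at-p : Statement2ℤ p
      at-p = concentrate p∈B (leaf-room l) tight
      m≤E : m ≤ E
      m≤E = subst (m ≤_) (Statement2ℤ.deg-x at-p) (Factor.lower (Statement2ℤ.factor at-p) p)

  -- Component counts and edge weights

  component-A component-B : Fin N → Fin N → ℤ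
  component-A x y = + count (λ v → σ x y v ∧ isA col v)
  component-B x y = + count (λ v → σ x y v ∧ isB col v)

  Statement3ℤ : Set
  Statement3ℤ = m * |A| ≤ n * |B|
    × (∀ x y → T x y ≡ true → col x ≡ true → n * component-B x y < m * component-A x y)

  component-const : ∀ p q x y →
    sum (λ v → 𝟙 (σ x y v) * (if col v then p else - q)) ≡ p * component-A x y - q * component-B x y
  component-const p q x y = trans (sum-cong-≗ pointwise)
    (trans (sum-minus (λ v → p * 𝟙 (σ x y v ∧ isA col v)) (λ v → q * 𝟙 (σ x y v ∧ isB col v)))
      (sym (cong₂ _-_ (*-count p (λ v → σ x y v ∧ isA col v)) (*-count q (λ v → σ x y v ∧ isB col v)))))
    where
    lemma₁ : ∀ p q → 1ℤ * p ≡ p * 1ℤ - q * 0ℤ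
    lemma₁ = solve-∀
    lemma₂ : ∀ p q → 1ℤ * - q ≡ p * 0ℤ - q * 1ℤ
    lemma₂ = solve-∀
    lemma₃ : ∀ p q r → 0ℤ * r ≡ p * 0ℤ - q * 0ℤ
    lemma₃ = solve-∀
    pointwise : ∀ v → 𝟙 (σ x y v) * (if col v then p else - q)
                    ≡ p * 𝟙 (σ x y v ∧ isA col v) - q * 𝟙 (σ x y v ∧ isB col v)
    pointwise v with σ x y v | col v
    ... | true  | true  = lemma₁ p q
    ... | true  | false = lemma₂ p q
    ... | false | c     = lemma₃ p q (if c then p else - q)

  -- In the signed degree sum over the component, the edges inside it cancel (`inner`), and the edge
  -- xy is the only one leaving it (`cross`).
  edge-weight : ∀ {h x y} → Weighting T h → T x y ≡ true →
    sgn x * h x y ≡ sum (λ w → 𝟙 (σ x y w) * (sgn w * deg h w))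
  edge-weight {h} {x} {y} W e = begin
    g x y
      ≡⟨ trans (sum-single y (λ u u≢y → off x u (λ _ → u≢y))) at-xy ⟨
    sum (cross x)
      ≡⟨ sum-single x (λ w w≢x → sum-zero (λ u → off w u (λ w≡x → contradiction w≡x w≢x))) ⟨
    sum (λ w → sum (cross w))                      ≡⟨ ℤₚ.+-identityˡ _ ⟨
    0ℤ + sum (λ w → sum (cross w))
      ≡⟨ cong (_+ sum (λ w → sum (cross w))) (sum-antisym inner inner-antisym) ⟨
    sum (λ w → sum (inner w)) + sum (λ w → sum (cross w))
      ≡⟨ ∑-distrib-+ (λ w → sum (inner w)) (λ w → sum (cross w)) ⟨
    sum (λ w → sum (inner w) + sum (cross w))      ≡⟨ sum-cong-≗ (λ w → ∑-distrib-+ (inner w) (cross w)) ⟨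
    sum (λ w → sum (λ u → inner w u + cross w u))
      ≡⟨ sum-cong-≗ (λ w → sum-cong-≗ (λ u → split (𝟙 (σ x y w)) (𝟙 (σ x y u)) (sgn w) (h w u))) ⟩
    sum (λ w → sum (λ u → 𝟙 (σ x y w) * sgn w * h w u))
      ≡⟨ sum-cong-≗ (λ w → *-distribˡ-sum (𝟙 (σ x y w) * sgn w) (h w)) ⟨
    sum (λ w → 𝟙 (σ x y w) * sgn w * deg h w)
      ≡⟨ sum-cong-≗ (λ w → ℤₚ.*-assoc (𝟙 (σ x y w)) (sgn w) (deg h w)) ⟩
    sum (λ w → 𝟙 (σ x y w) * (sgn w * deg h w))    ∎
    where
    open ≡-Reasoning
    open Weighting W
    g inner cross : Fin N → Fin N → ℤ
    g w u     = sgn w * h w u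
    inner w u = 𝟙 (σ x y w) * 𝟙 (σ x y u) * g w u
    cross w u = 𝟙 (σ x y w) * (1ℤ - 𝟙 (σ x y u)) * g w u
    split : ∀ a b s k → a * b * (s * k) + a * (1ℤ - b) * (s * k) ≡ a * s * k
    split = solve-∀
    inner-antisym : ∀ u v → inner u v ≡ - inner v u
    inner-antisym u v with T u v in uv
    ... | false rewrite supported u v uv | supported v u (trans (T-sym v u) uv) =
      lemma (𝟙 (σ x y u)) (𝟙 (σ x y v)) (sgn u) (sgn v)
      where
      lemma : ∀ a b s t → a * b * (s * 0ℤ) ≡ - (b * a * (t * 0ℤ))
      lemma = solve-∀
    ... | true rewrite symmetric u v | sgn-adj uv = lemma (𝟙 (σ x y u)) (𝟙 (σ x y v)) (sgn u) (h v u)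
      where
      lemma : ∀ a b s k → a * b * (s * k) ≡ - (b * a * (- s * k))
      lemma = solve-∀
    off : ∀ w u → (w ≡ x → u ≢ y) → cross w u ≡ 0ℤ
    off w u ≢xy with σ x y w in sw
    ... | false = refl
    ... | true with T w u in wu
    ...   | false rewrite supported w u wu = lemma (1ℤ - 𝟙 (σ x y u)) (sgn w)
      where
      lemma : ∀ a s → 1ℤ * a * (s * 0ℤ) ≡ 0ℤ
      lemma = solve-∀
    ...   | true with σ-step wu sw
    ...     | inj₁ su rewrite su = refl
    ...     | inj₂ (w≡x , u≡y) = contradiction u≡y (≢xy w≡x)
    at-xy : cross x y ≡ g x y
    at-xy rewrite σ-near e | σ-far x y = ℤₚ.*-identityˡ (g x y)

  σ⇒≢ : ∀ {x y w} → σ x y w ≡ true → w ≢ y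
  σ⇒≢ {x} {y} s refl = contradiction (trans (sym s) (σ-far x y)) λ ()

  2⇒3 : (∃ λ b → col b ≡ false) → (∀ x → col x ≡ false → Statement2ℤ x) → Statement3ℤ
  2⇒3 (b , b∈B) st2 = total , edge
    where
    total : m * |A| ≤ n * |B|
    -- The inequality restates that the degree `E` at the exceptional vertex is at most `n`.
    total = ℤₚ.i-j≤0⇒i≤j (subst (_≤ 0ℤ) (lemma n (m * |A|) (n * |B|))
      (ℤₚ.i≤j⇒i-j≤0 (subst (_≤ n) deg-x (Factor.upper factor b))))
      where
      open Statement2ℤ (st2 b b∈B)
      lemma : ∀ n a c → (n + a - c) - n ≡ a - c
      lemma = solve-∀
    edge : ∀ x y → T x y ≡ true → col x ≡ true → n * component-B x y < m * component-A x y
    edge x y e x∈A = 0<i-j⇒j<i (subst (0ℤ <_) weight (positive x y e))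
      where
      y∈B : col y ≡ false
      y∈B = adj-A e x∈A
      -- Taking `y` as the exceptional vertex places it outside the component of `x`, where all
      -- vertices of B then have full degree `n`.
      open Statement2ℤ (st2 y y∈B)
      term : ∀ w → 𝟙 (σ x y w) * (sgn w * deg h w) ≡ 𝟙 (σ x y w) * (if col w then m else - n)
      term w with σ x y w in s
      ... | false = refl
      ... | true with colour w
      ...   | inj₁ w∈A rewrite deg-A w w∈A | w∈A = cong (1ℤ *_) (ℤₚ.*-identityˡ m)
      ...   | inj₂ w∈B rewrite deg-B w w∈B (σ⇒≢ s) | w∈B = cong (1ℤ *_) (ℤₚ.-1*i≡-i n)
      weight : h x y ≡ m * component-A x y - n * component-B x y
      weight = begin
        h x y                                                   ≡⟨ ℤₚ.*-identityˡ (h x y) ⟨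
        1ℤ * h x y                                              ≡⟨ cong (_* h x y) (sgn-A x∈A) ⟨
        sgn x * h x y                                           ≡⟨ edge-weight (Factor.weighting factor) e ⟩
        sum (λ w → 𝟙 (σ x y w) * (sgn w * deg h w))             ≡⟨ sum-cong-≗ term ⟩
        sum (λ w → 𝟙 (σ x y w) * (if col w then m else - n))    ≡⟨ component-const m n x y ⟩
        m * component-A x y - n * component-B x y               ∎
        where open ≡-Reasoning

  -- Only xy leaves the component, so without it the B-part isolates the A-part. A general `G`
  -- accommodates both orientations of the deleted edge.
  component-isolated : ∀ {x y} → T x y ≡ true → (G : Graph N) →
    (∀ {u v} → G u v ≡ true → deleteEdge T x y u v ≡ true) →
    component-A x y ≤ + iso G (λ v → σ x y v ∧ isB col v)
  component-isolated {x} {y} e G G⊆ = iso-≥ G _ _ isolated-A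
    where
    isolated-A : ∀ v → σ x y v ∧ isA col v ≡ true →
      σ x y v ∧ isB col v ≡ false × (∀ u → G v u ≡ true → σ x y u ∧ isB col u ≡ true)
    isolated-A v v∈ with σ x y v in s | colour v
    ... | true | inj₂ v∈B = contradiction (trans (sym v∈) v∈B) λ ()
    ... | true | inj₁ v∈A = cong not v∈A , λ u d → cong₂ _∧_
      (reach⇒σ e (reach-trans (σ⇒reach s) (there (G⊆ d) here)))
      (cong not (adj-A (deleteEdge-⊆ T (G⊆ d)) v∈A))

  3⇒iso-T-e : Statement3ℤ →
    ∀ x y → T x y ≡ true → ∃ λ S → n * + count S < m * + iso (deleteEdge T x y) S
  3⇒iso-T-e (_ , edge) x y e with colour x
  ... | inj₁ x∈A = _ , ℤₚ.<-≤-trans (edge x y e x∈A)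
    (m*-mono (component-isolated e (deleteEdge T x y) (λ d → d)))
  ... | inj₂ x∈B = _ , ℤₚ.<-≤-trans (edge y x (adj-sym e) y∈A)
    (m*-mono
      (component-isolated (adj-sym e) (deleteEdge T x y) (λ d → trans (sym (deleteEdge-swap T x y _ _)) d)))
    where
    y∈A : col y ≡ true
    y∈A = adj-B e x∈B

  2⇒iso-T : ∀ {x} → Statement2ℤ x → ∀ S → m * + iso T S ≤ n * + count S
  2⇒iso-T st2 = iso-bound m n (Factor.weighting factor) (Factor.lower factor) (Factor.upper factor)
    where open Statement2ℤ st2

  -- The weighting solving the degree prescription, constructed from 3)

  module Solution (st3 : Statement3ℤ) (x : Fin N) (x∈B : col x ≡ false) where

    -- The signed degrees prescribed by 2): at `x` the correction replaces `- n` by `- E`, which is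
    -- what makes the total zero.
    demand : Fin N → ℤ
    demand w = (if col w then m else - n) + restrict x (λ _ → n - E) w

    n-E : n - E ≡ n * |B| - m * |A|
    n-E = lemma n (m * |A|) (n * |B|)
      where
      lemma : ∀ n a b → n - (n + a - b) ≡ b - a
      lemma = solve-∀

    0≤n-E : 0ℤ ≤ n - E
    0≤n-E = subst (0ℤ ≤_) (sym n-E) (ℤₚ.i≤j⇒0≤j-i (proj₁ st3))

    sum-demand : sum demand ≡ 0ℤ
    sum-demand = begin
      sum demand
        ≡⟨ ∑-distrib-+ (λ w → if col w then m else - n) (restrict x (λ _ → n - E)) ⟩
      sum (λ w → if col w then m else - n) + sum (restrict x (λ _ → n - E))
        ≡⟨ cong₂ _+_ (signed-const m n) (sum-restrict x (λ _ → n - E)) ⟩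
      m * |A| - n * |B| + (n - E)                      ≡⟨ lemma n (m * |A|) (n * |B|) ⟩
      0ℤ                                               ∎
      where
      open ≡-Reasoning
      lemma : ∀ n a b → a - b + (n - (n + a - b)) ≡ 0ℤ
      lemma = solve-∀

    flow : Fin N → Fin N → ℤ
    flow u v = sum (λ w → 𝟙 (σ u v w) * demand w)

    flow-nonadj : ∀ {u v} → T u v ≡ false → flow u v ≡ 0ℤ
    flow-nonadj e = sum-zero (λ w → cong (λ b → 𝟙 b * demand w) (σ-nonadj w e))

    flow-antisym : ∀ u v → flow v u ≡ - flow u v
    flow-antisym u v with T u v in e
    ... | false rewrite flow-nonadj e | flow-nonadj (trans (T-sym v u) e) = refl
    ... | true = begin
      flow v u                                                   ≡⟨ sum-cong-≗ complement ⟩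
      sum (λ w → demand w - 𝟙 (σ u v w) * demand w)
        ≡⟨ sum-minus demand (λ w → 𝟙 (σ u v w) * demand w) ⟩
      sum demand - flow u v                                      ≡⟨ cong (_- flow u v) sum-demand ⟩
      0ℤ - flow u v                                              ≡⟨ ℤₚ.+-identityˡ _ ⟩
      - flow u v                                                 ∎
      where
      open ≡-Reasoning
      lemma : ∀ a d → (1ℤ - a) * d ≡ d - a * d
      lemma = solve-∀
      complement : ∀ w → 𝟙 (σ v u w) * demand w ≡ demand w - 𝟙 (σ u v w) * demand w
      complement w rewrite 𝟙-compl e w = lemma (𝟙 (σ u v w)) (demand w)

    -- The branches at `u` contain each vertex other than `u` exactly once, so together they collect
    -- the total demand, which is zero, minus that of `u`.
    inflow : ∀ u → sum (λ v → flow v u) ≡ - demand u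
    inflow u = begin
      sum (λ v → sum (λ w → 𝟙 (σ v u w) * demand w))       ≡⟨ ∑-comm (λ v w → 𝟙 (σ v u w) * demand w) ⟩
      sum (λ w → sum (λ v → 𝟙 (σ v u w) * demand w))
        ≡⟨ sum-cong-≗ (λ w → *-distribʳ-sum (demand w) (λ v → 𝟙 (σ v u w))) ⟨
      sum (λ w → sum (λ v → 𝟙 (σ v u w)) * demand w)       ≡⟨ sum-cong-≗ elsewhere ⟩
      sum (λ w → demand w - restrict u demand w)           ≡⟨ sum-minus demand (restrict u demand) ⟩
      sum demand - sum (restrict u demand)                 ≡⟨ cong₂ _-_ sum-demand (sum-restrict u demand) ⟩
      0ℤ - demand u                                        ≡⟨ ℤₚ.+-identityˡ _ ⟩
      - demand u                                           ∎
      where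
      open ≡-Reasoning
      elsewhere : ∀ w → sum (λ v → 𝟙 (σ v u w)) * demand w ≡ demand w - restrict u demand w
      elsewhere w rewrite σ-branches u w with u ≟ w | w ≟ u
      ... | yes _    | yes _   = sym (ℤₚ.+-inverseʳ (demand w))
      ... | no _     | no _    = trans (ℤₚ.*-identityˡ (demand w)) (sym (ℤₚ.+-identityʳ (demand w)))
      ... | yes refl | no w≢u  = contradiction refl w≢u
      ... | no u≢w   | yes refl = contradiction refl u≢w

    outflow : ∀ u → sum (flow u) ≡ demand u
    outflow u = begin
      sum (flow u)                   ≡⟨ sum-cong-≗ (λ v → flow-antisym v u) ⟩
      sum (λ v → - flow v u)         ≡⟨ sum-neg (λ v → flow v u) ⟩
      - sum (λ v → flow v u)         ≡⟨ cong -_ (inflow u) ⟩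
      - - demand u                   ≡⟨ ℤₚ.neg-involutive (demand u) ⟩
      demand u                       ∎
      where open ≡-Reasoning

    -- The edge inequality of 3) gives a positive part; the correction at `x`, if `x` lies in the
    -- component, adds `n - E`, which is nonnegative by the global inequality.
    flow-positive : ∀ {u v} → T u v ≡ true → col u ≡ true → 0ℤ < flow u v
    flow-positive {u} {v} e u∈A = subst (0ℤ <_) (sym split)
      (ℤₚ.+-mono-<-≤ (j<i⇒0<i-j (proj₂ st3 u v e u∈A)) (sum-nonNeg extra))
      where
      open ≡-Reasoning
      extra : ∀ w → 0ℤ ≤ 𝟙 (σ u v w) * restrict x (λ _ → n - E) w
      extra w with σ u v w | w ≟ x
      ... | false | _     = ℤₚ.≤-refl
      ... | true  | no _  = ℤₚ.≤-refl
      ... | true  | yes _ = subst (0ℤ ≤_) (sym (ℤₚ.*-identityˡ (n - E))) 0≤n-E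
      split : flow u v ≡ (m * component-A u v - n * component-B u v)
                         + sum (λ w → 𝟙 (σ u v w) * restrict x (λ _ → n - E) w)
      split = begin
        flow u v
          ≡⟨ sum-cong-≗ (λ w → ℤₚ.*-distribˡ-+ (𝟙 (σ u v w)) (if col w then m else - n) (restrict x (λ _ → n - E) w)) ⟩
        sum (λ w → 𝟙 (σ u v w) * (if col w then m else - n) + 𝟙 (σ u v w) * restrict x (λ _ → n - E) w)
          ≡⟨ ∑-distrib-+ (λ w → 𝟙 (σ u v w) * (if col w then m else - n)) _ ⟩
        sum (λ w → 𝟙 (σ u v w) * (if col w then m else - n)) + sum (λ w → 𝟙 (σ u v w) * restrict x (λ _ → n - E) w)
          ≡⟨ cong (_+ sum (λ w → 𝟙 (σ u v w) * restrict x (λ _ → n - E) w)) (component-const m n u v) ⟩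
        (m * component-A u v - n * component-B u v) + sum (λ w → 𝟙 (σ u v w) * restrict x (λ _ → n - E) w)  ∎

    h : Fin N → Fin N → ℤ
    h u v = sgn u * flow u v

    h-sym : ∀ u v → h u v ≡ h v u
    h-sym u v with T u v in e
    ... | false rewrite flow-nonadj e | flow-nonadj (trans (T-sym v u) e) =
      trans (ℤₚ.*-zeroʳ (sgn u)) (sym (ℤₚ.*-zeroʳ (sgn v)))
    ... | true rewrite flow-antisym u v | sgn-adj e = lemma (sgn u) (flow u v)
      where
      lemma : ∀ a b → a * b ≡ - a * - b
      lemma = solve-∀

    positive : ∀ u v → T u v ≡ true → 0ℤ < h u v
    positive u v e with colour u
    ... | inj₁ u∈A = subst (0ℤ <_) (trans (sym (ℤₚ.*-identityˡ (flow u v))) (cong (_* flow u v) (sym (sgn-A u∈A))))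
                       (flow-positive e u∈A)
    ... | inj₂ u∈B = subst (0ℤ <_)
        (trans (trans (sym (ℤₚ.*-identityˡ (flow v u))) (cong (_* flow v u) (sym (sgn-A v∈A)))) (h-sym v u))
        (flow-positive (adj-sym e) v∈A)
      where
      v∈A : col v ≡ true
      v∈A = adj-B e u∈B

    weighting : Weighting T h
    weighting = record { symmetric = h-sym ; supported = supported ; nonNeg = nonNeg }
      where
      supported : ∀ u v → T u v ≡ false → h u v ≡ 0ℤ
      supported u v e rewrite flow-nonadj e = ℤₚ.*-zeroʳ (sgn u)
      nonNeg : ∀ u v → 0ℤ ≤ h u v
      nonNeg u v with T u v in e
      ... | true  = ℤₚ.<⇒≤ (positive u v e)
      ... | false = ℤₚ.≤-reflexive (sym (supported u v e))

    deg-h : ∀ u → deg h u ≡ sgn u * demand u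
    deg-h u = trans (sym (*-distribˡ-sum (sgn u) (flow u))) (cong (sgn u *_) (outflow u))

    deg-A : ∀ a → col a ≡ true → deg h a ≡ m
    deg-A a a∈A rewrite deg-h a | restrict-≢ {i = a} {x} (λ _ → n - E) (A≢B a∈A x∈B) | a∈A =
      lemma m
      where
      lemma : ∀ m → 1ℤ * (m + 0ℤ) ≡ m
      lemma = solve-∀

    deg-B : ∀ b → col b ≡ false → b ≢ x → deg h b ≡ n
    deg-B b b∈B b≢x rewrite deg-h b | restrict-≢ (λ _ → n - E) b≢x | b∈B = lemma n
      where
      lemma : ∀ n → -1ℤ * (- n + 0ℤ) ≡ n
      lemma = solve-∀

    deg-x : deg h x ≡ E
    deg-x rewrite deg-h x | x∈B with x ≟ x
    ... | yes _  = lemma n (n + m * |A| - n * |B|)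
      where
      lemma : ∀ n e → -1ℤ * (- n + (n - e)) ≡ e
      lemma = solve-∀
    ... | no x≢x = contradiction refl x≢x

  3⇒2 : |B| ≤ |A| → Statement3ℤ → ∀ x → col x ≡ false → Statement2ℤ x
  3⇒2 |B|≤|A| st3 x x∈B = record
    { h = h ; factor = record { weighting = weighting ; lower = lower ; upper = upper }
    ; positive = positive ; deg-A = deg-A ; deg-B = deg-B ; deg-x = deg-x }
    where
    open Solution st3 x x∈B
    E≤n : E ≤ n
    E≤n = ℤₚ.0≤i-j⇒j≤i 0≤n-E
    m≤E : m ≤ E
    -- `E` is the same for every exceptional vertex, so it can be read off the solution for `p`,
    -- whose degree is at least that of its leaf.
    m≤E with leaf-exists |B|≤|A| x x∈B
    ... | a , p , l = subst₂ _≤_ (Solution.deg-A st3 p p∈B a (proj₁ l)) (Solution.deg-x st3 p p∈B)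
                        (leaf-deg-≤ (Solution.weighting st3 p p∈B) l)
      where
      p∈B : col p ≡ false
      p∈B = adj-A (proj₁ (proj₂ l)) (proj₁ l)
    lower : ∀ v → m ≤ deg h v
    lower v with colour v | v ≟ x
    ... | inj₁ v∈A | _        = ℤₚ.≤-reflexive (sym (deg-A v v∈A))
    ... | inj₂ _   | yes refl = subst (m ≤_) (sym deg-x) m≤E
    ... | inj₂ v∈B | no v≢x   = subst (m ≤_) (sym (deg-B v v∈B v≢x)) (ℤₚ.<⇒≤ m<n)
    upper : ∀ v → deg h v ≤ n
    upper v with colour v | v ≟ x
    ... | inj₁ v∈A | _        = subst (_≤ n) (sym (deg-A v v∈A)) (ℤₚ.<⇒≤ m<n)
    ... | inj₂ _   | yes refl = subst (_≤ n) (sym deg-x) E≤n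
    ... | inj₂ v∈B | no v≢x   = ℤₚ.≤-reflexive (deg-B v v∈B v≢x)

-- The embedding of the integers as multiples of 1/m

module Scale (m-1 : ℕ) where
  m : ℕ
  m = suc m-1

  -- `n /ₙ m` is definitionally `φ (+ n)`. Identities are checked on unnormalised fractions, which
  -- keep the denominator `m` and involve no gcd.
  φ : ℤ → ℚ
  φ i = fromℚᵘ (mkℚᵘ i m-1)

  toℚᵘ-φ : ∀ i → toℚᵘ (φ i) ℚᵘ.≃ mkℚᵘ i m-1
  toℚᵘ-φ i = ℚₚ.toℚᵘ-fromℚᵘ (mkℚᵘ i m-1)

  φ-+ : ∀ i j → φ (i ℤ.+ j) ≡ φ i ℚ.+ φ j
  φ-+ i j = ℚₚ.toℚᵘ-injective (begin
    toℚᵘ (φ (i ℤ.+ j))              ≈⟨ toℚᵘ-φ _ ⟩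
    mkℚᵘ (i ℤ.+ j) m-1              ≈⟨ *≡* (lemma i j (+ m)) ⟩
    mkℚᵘ i m-1 ℚᵘ.+ mkℚᵘ j m-1      ≈⟨ ℚᵘₚ.+-cong (toℚᵘ-φ i) (toℚᵘ-φ j) ⟨
    toℚᵘ (φ i) ℚᵘ.+ toℚᵘ (φ j)      ≈⟨ ℚₚ.toℚᵘ-homo-+ (φ i) (φ j) ⟨
    toℚᵘ (φ i ℚ.+ φ j)              ∎)
    where
    open ℚᵘₚ.≃-Reasoning
    lemma : ∀ i j k → (i ℤ.+ j) ℤ.* (k ℤ.* k) ≡ (i ℤ.* k ℤ.+ j ℤ.* k) ℤ.* k
    lemma = solve-∀

  φ-neg : ∀ i → φ (ℤ.- i) ≡ ℚ.- φ i
  φ-neg i = ℚₚ.toℚᵘ-injective (begin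
    toℚᵘ (φ (ℤ.- i))      ≈⟨ toℚᵘ-φ _ ⟩
    ℚᵘ.- mkℚᵘ i m-1       ≈⟨ ℚᵘₚ.-‿cong (toℚᵘ-φ i) ⟨
    ℚᵘ.- toℚᵘ (φ i)       ≈⟨ ℚₚ.toℚᵘ-homo‿- (φ i) ⟨
    toℚᵘ (ℚ.- φ i)        ∎)
    where open ℚᵘₚ.≃-Reasoning

  φ-mono-≤ : ∀ {i j} → i ℤ.≤ j → φ i ℚ.≤ φ j
  φ-mono-≤ {i} {j} i≤j = ℚₚ.toℚᵘ-cancel-≤ (begin
    toℚᵘ (φ i)   ≃⟨ toℚᵘ-φ i ⟩
    mkℚᵘ i m-1   ≤⟨ *≤* (ℤₚ.*-monoʳ-≤-nonNeg (+ m) i≤j) ⟩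
    mkℚᵘ j m-1   ≃⟨ toℚᵘ-φ j ⟨
    toℚᵘ (φ j)   ∎)
    where open ℚᵘₚ.≤-Reasoning

  φ-mono-< : ∀ {i j} → i ℤ.< j → φ i ℚ.< φ j
  φ-mono-< {i} {j} i<j = ℚₚ.toℚᵘ-cancel-< (begin-strict
    toℚᵘ (φ i)   ≃⟨ toℚᵘ-φ i ⟩
    mkℚᵘ i m-1   <⟨ *<* (ℤₚ.*-monoʳ-<-pos (+ m) i<j) ⟩
    mkℚᵘ j m-1   ≃⟨ toℚᵘ-φ j ⟨
    toℚᵘ (φ j)   ∎)
    where open ℚᵘₚ.≤-Reasoning

  φ-cancel-≤ : ∀ {i j} → φ i ℚ.≤ φ j → i ℤ.≤ j
  φ-cancel-≤ φi≤φj = ℤₚ.≮⇒≥ λ j<i → ℚₚ.<-irrefl refl (ℚₚ.<-≤-trans (φ-mono-< j<i) φi≤φj)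

  φ-cancel-< : ∀ {i j} → φ i ℚ.< φ j → i ℤ.< j
  φ-cancel-< φi<φj = ℤₚ.≰⇒> λ j≤i → ℚₚ.<-irrefl refl (ℚₚ.<-≤-trans φi<φj (φ-mono-≤ j≤i))

  φ-injective : ∀ {i j} → φ i ≡ φ j → i ≡ j
  φ-injective eq = ℤₚ.≤-antisym (φ-cancel-≤ (ℚₚ.≤-reflexive eq)) (φ-cancel-≤ (ℚₚ.≤-reflexive (sym eq)))

  ⟦⟧-φ : ∀ c → ⟦ c ⟧ ≡ φ (+ m ℤ.* + c)
  ⟦⟧-φ c = ℚₚ.toℚᵘ-injective (begin
    toℚᵘ ⟦ c ⟧                  ≈⟨ ℚₚ.toℚᵘ-fromℚᵘ (mkℚᵘ (+ c) 0) ⟩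
    mkℚᵘ (+ c) 0                ≈⟨ *≡* (lemma (+ c) (+ m)) ⟩
    mkℚᵘ (+ m ℤ.* + c) m-1      ≈⟨ toℚᵘ-φ _ ⟨
    toℚᵘ (φ (+ m ℤ.* + c))      ∎)
    where
    open ℚᵘₚ.≃-Reasoning
    lemma : ∀ c k → c ℤ.* k ≡ (k ℤ.* c) ℤ.* + 1
    lemma = solve-∀

  *⟦⟧-φ : ∀ n c → (n /ₙ m) ℚ.* ⟦ c ⟧ ≡ φ (+ n ℤ.* + c)
  *⟦⟧-φ n c = ℚₚ.toℚᵘ-injective (begin
    toℚᵘ ((n /ₙ m) ℚ.* ⟦ c ⟧)                ≈⟨ ℚₚ.toℚᵘ-homo-* (n /ₙ m) ⟦ c ⟧ ⟩
    toℚᵘ (n /ₙ m) ℚᵘ.* toℚᵘ ⟦ c ⟧            ≈⟨ ℚᵘₚ.*-cong (toℚᵘ-φ (+ n)) (ℚₚ.toℚᵘ-fromℚᵘ (mkℚᵘ (+ c) 0)) ⟩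
    mkℚᵘ (+ n) m-1 ℚᵘ.* mkℚᵘ (+ c) 0         ≈⟨ *≡* (lemma (+ n) (+ c) (+ m)) ⟩
    mkℚᵘ (+ n ℤ.* + c) m-1                   ≈⟨ toℚᵘ-φ _ ⟨
    toℚᵘ (φ (+ n ℤ.* + c))                   ∎)
    where
    open ℚᵘₚ.≃-Reasoning
    lemma : ∀ n c k → (n ℤ.* c) ℤ.* k ≡ (n ℤ.* c) ℤ.* (k ℤ.* + 1)
    lemma = solve-∀

  φ-0 : φ (+ 0) ≡ 0ℚ
  φ-0 = ℚₚ.toℚᵘ-injective (begin
    toℚᵘ (φ (+ 0))   ≈⟨ toℚᵘ-φ (+ 0) ⟩
    mkℚᵘ (+ 0) m-1   ≈⟨ *≡* refl ⟩
    toℚᵘ 0ℚ          ∎)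
    where open ℚᵘₚ.≃-Reasoning

-- Transfer between rational and integral statements

module Transfer (n m-1 : ℕ) (m<n : suc m-1 ℕ.< n)
  {N : ℕ} (T : Graph N) (T-tree : Tree T) (col : Fin N → Bool) (bip : Bipartition T col) where
  open Scale m-1
  open import Data.Integer using (_≤_; _<_)
  open Flows T T-tree col bip
  open Factors T T-tree col bip (+ m) (+ n) (ℤ.+<+ (ℕ.s≤s ℕ.z≤n)) (ℤ.+<+ m<n)

  ⟦⟧≤⇒ : ∀ {a b} → ⟦ a ⟧ ℚ.≤ (n /ₙ m) ℚ.* ⟦ b ⟧ → + m * + a ≤ + n * + b
  ⟦⟧≤⇒ {a} {b} le = φ-cancel-≤ (subst₂ ℚ._≤_ (⟦⟧-φ a) (*⟦⟧-φ n b) le)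

  ⟦⟧≤⇐ : ∀ {a b} → + m * + a ≤ + n * + b → ⟦ a ⟧ ℚ.≤ (n /ₙ m) ℚ.* ⟦ b ⟧
  ⟦⟧≤⇐ {a} {b} le = subst₂ ℚ._≤_ (sym (⟦⟧-φ a)) (sym (*⟦⟧-φ n b)) (φ-mono-≤ le)

  ⟦⟧>⇒ : ∀ {a b} → ⟦ a ⟧ ℚ.> (n /ₙ m) ℚ.* ⟦ b ⟧ → + n * + b < + m * + a
  ⟦⟧>⇒ {a} {b} lt = φ-cancel-< (subst₂ ℚ._<_ (*⟦⟧-φ n b) (⟦⟧-φ a) lt)

  ⟦⟧>⇐ : ∀ {a b} → + n * + b < + m * + a → ⟦ a ⟧ ℚ.> (n /ₙ m) ℚ.* ⟦ b ⟧
  ⟦⟧>⇐ {a} {b} lt = subst₂ ℚ._<_ (sym (*⟦⟧-φ n b)) (sym (⟦⟧-φ a)) (φ-mono-< lt)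

  ⟦1⟧ : ⟦ 1 ⟧ ≡ φ (+ m)
  ⟦1⟧ = trans (⟦⟧-φ 1) (cong φ (ℤₚ.*-identityʳ (+ m)))

  φ-E : φ E ≡ (n /ₙ m) ℚ.+ ⟦ count (isA col) ⟧ ℚ.- (n /ₙ m) ℚ.* ⟦ count (isB col) ⟧
  φ-E = trans (φ-+ (+ n + + m * |A|) (- (+ n * |B|))) (cong₂ ℚ._+_
    (trans (φ-+ (+ n) (+ m * |A|)) (cong (φ (+ n) ℚ.+_) (sym (⟦⟧-φ (count (isA col))))))
    (trans (φ-neg (+ n * |B|)) (cong ℚ.-_ (sym (*⟦⟧-φ n (count (isB col)))))))

  sumFin-φ : ∀ {k} {f : Fin k → ℚ} {g : Fin k → ℤ} → (∀ i → f i ≡ φ (g i)) → sumFin f ≡ φ (sum g)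
  sumFin-φ {zero}          f≗φg = sym φ-0
  sumFin-φ {suc k} {g = g} f≗φg = trans (cong₂ ℚ._+_ (f≗φg zero) (sumFin-φ (f≗φg ∘ suc)))
                                        (sym (φ-+ (g zero) (sum (g ∘ suc))))

  degree-φ : ∀ {hq h} → (∀ u v → T u v ≡ true → hq u v ≡ φ (h u v)) →
    (∀ u v → T u v ≡ false → h u v ≡ 0ℤ) → ∀ v → degree T hq v ≡ φ (deg h v)
  degree-φ {hq} {h} adj nonadj v = sumFin-φ term
    where
    term : ∀ u → (if T v u then hq v u else 0ℚ) ≡ φ (h v u)
    term u with T v u in e
    ... | true  = adj v u e
    ... | false = trans (sym φ-0) (cong φ (sym (nonadj v u e)))

  integral⇒2 : ∀ {x} → Statement2ℤ x → Σ (Fin N → Fin N → ℚ) λ h →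
      FractionalFactor T ⟦ 1 ⟧ (n /ₙ m) h
      × ValuesInSteps m T h
      × (∀ a → col a ≡ true → degree T h a ≡ ⟦ 1 ⟧)
      × (∀ b → col b ≡ false → b ≢ x → degree T h b ≡ n /ₙ m)
      × (degree T h x ≡ (n /ₙ m) ℚ.+ ⟦ count (isA col) ⟧ ℚ.- (n /ₙ m) ℚ.* ⟦ count (isB col) ⟧)
  integral⇒2 {x} st2 = hq
    , ( (λ u v _ → cong φ (symmetric u v))
      , (λ u v e → subst (ℚ._≤ hq u v) φ-0 (φ-mono-≤ (nonNeg u v))
                 , subst (hq u v ℚ.≤_) (sym ⟦1⟧) (φ-mono-≤ (h≤m u v e)))
      , (λ v → subst₂ ℚ._≤_ (sym ⟦1⟧) (sym (degree-h v)) (φ-mono-≤ (lower v))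
             , subst (ℚ._≤ (n /ₙ m)) (sym (degree-h v)) (φ-mono-≤ (upper v))))
    , steps
    , (λ a a∈A → trans (degree-h a) (trans (cong φ (deg-A a a∈A)) (sym ⟦1⟧)))
    , (λ b b∈B b≢x → trans (degree-h b) (cong φ (deg-B b b∈B b≢x)))
    , trans (degree-h x) (trans (cong φ deg-x) φ-E)
    where
    open Statement2ℤ st2
    open Factor factor
    open Weighting weighting
    hq : Fin N → Fin N → ℚ
    hq u v = φ (h u v)
    degree-h : ∀ v → degree T hq v ≡ φ (deg h v)
    degree-h = degree-φ (λ _ _ _ → refl) supported
    -- One end of the edge lies in A, and its degree `m` bounds each of its nonnegative terms.
    h≤m : ∀ u v → T u v ≡ true → h u v ≤ + m
    h≤m u v e with colour u
    ... | inj₁ u∈A = subst (h u v ≤_) (deg-A u u∈A) (term-≤-sum (nonNeg u) v)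
    ... | inj₂ u∈B = subst₂ _≤_ (symmetric v u)
      (deg-A v (adj-B e u∈B)) (term-≤-sum (nonNeg v) u)
    steps : ValuesInSteps m T hq
    steps u v e = ℤ.∣ h u v ∣
      , ℤₚ.drop‿+<+ (subst (0ℤ <_) (sym abs) (positive u v e))
      , ℤₚ.drop‿+≤+ (subst (_≤ + m) (sym abs) (h≤m u v e))
      , cong φ (sym abs)
      where
      abs : + ℤ.∣ h u v ∣ ≡ h u v
      abs = ℤₚ.0≤i⇒+∣i∣≡i (nonNeg u v)

  -- The numerators granted by `ValuesInSteps` are extended by zero off the edges; their symmetry is
  -- regained from that of the rational weights, as `φ` is injective.
  2⇒integral : Statement2 n m T col → ∀ x → col x ≡ false → Statement2ℤ x
  2⇒integral st2 x x∈B with st2 x x∈B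
  ... | hq , (hq-sym , _ , bounds) , steps , degree-A , degree-B , degree-x =
    build (λ u v → proj₁ (numerator u v)) (λ u v → proj₁ (proj₂ (numerator u v)))
          (λ u v → proj₂ (proj₂ (numerator u v)))
    where
    numerator : ∀ u v → ∃ λ i → (T u v ≡ true → hq u v ≡ φ i × 0ℤ < i) × (T u v ≡ false → i ≡ 0ℤ)
    numerator u v with T u v in e
    ... | false = 0ℤ , (λ ()) , λ _ → refl
    ... | true with steps u v e
    ...   | k , 1≤k , _ , eq = + k , (λ _ → eq , ℤ.+<+ 1≤k) , λ ()
    build : (h : Fin N → Fin N → ℤ) → (∀ u v → T u v ≡ true → hq u v ≡ φ (h u v) × 0ℤ < h u v) →
      (∀ u v → T u v ≡ false → h u v ≡ 0ℤ) → Statement2ℤ x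
    build h adj nonadj = record
      { h = h
      ; factor = record
        { weighting = record { symmetric = symmetric ; supported = nonadj ; nonNeg = nonNeg }
        ; lower = λ v → φ-cancel-≤ (subst₂ ℚ._≤_ ⟦1⟧ (degree-h v) (proj₁ (bounds v)))
        ; upper = λ v → φ-cancel-≤ (subst (ℚ._≤ (n /ₙ m)) (degree-h v) (proj₂ (bounds v))) }
      ; positive = λ u v e → proj₂ (adj u v e)
      ; deg-A = λ a a∈A → φ-injective (trans (sym (degree-h a)) (trans (degree-A a a∈A) ⟦1⟧))
      ; deg-B = λ b b∈B b≢x → φ-injective (trans (sym (degree-h b)) (degree-B b b∈B b≢x))
      ; deg-x = φ-injective (trans (sym (degree-h x)) (trans degree-x (sym φ-E))) }
      where
      degree-h : ∀ v → degree T hq v ≡ φ (deg h v)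
      degree-h = degree-φ (λ u v e → proj₁ (adj u v e)) nonadj
      symmetric : ∀ u v → h u v ≡ h v u
      symmetric u v with T u v in e
      ... | false = trans (nonadj u v e) (sym (nonadj v u (trans (T-sym v u) e)))
      ... | true  = φ-injective (trans (sym (proj₁ (adj u v e)))
                      (trans (hq-sym u v e) (proj₁ (adj v u (adj-sym e)))))
      nonNeg : ∀ u v → 0ℤ ≤ h u v
      nonNeg u v with T u v in e
      ... | true  = ℤₚ.<⇒≤ (proj₂ (adj u v e))
      ... | false = ℤₚ.≤-reflexive (sym (nonadj u v e))

  3⇒integral : Statement3 n m T col → Statement3ℤ
  3⇒integral (total , edge) = ⟦⟧≤⇒ total , λ x y e x∈A →
    ⟦⟧>⇒ (edge x y e x∈A (σ x y) (λ v → σ⇒reach , reach⇒σ e))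

  integral⇒3 : Statement3ℤ → Statement3 n m T col
  integral⇒3 (total , edge) = ⟦⟧≤⇐ total , λ x y e x∈A C C-comp →
    let C≗σ : ∀ v → C v ≡ σ x y v
        C≗σ v = ≡-from-true (λ c → reach⇒σ e (proj₁ (C-comp v) c)) (λ s → proj₂ (C-comp v) (σ⇒reach s))
    in ⟦⟧>⇐ (subst₂ (λ a b → + n * + b < + m * + a)
         (count-cong (λ v → cong (_∧ isA col v) (sym (C≗σ v))))
         (count-cong (λ v → cong (_∧ isB col v) (sym (C≗σ v))))
         (edge x y e x∈A))
    where
    ≡-from-true : ∀ {a b} → (a ≡ true → b ≡ true) → (b ≡ true → a ≡ true) → a ≡ b
    ≡-from-true {true}  {b}     f g = sym (f refl)
    ≡-from-true {false} {false} f g = refl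
    ≡-from-true {false} {true}  f g = g refl

  B-inhabited : 0 ℕ.< count (isB col) → ∃ λ b → col b ≡ false
  B-inhabited 0<|B| with count-positive (isB col) 0<|B|
  ... | b , b∈B = b , trans (sym (Boolₚ.not-involutive (col b))) (cong not b∈B)

  InClassT⇒2 : count (isB col) ℕ.≤ count (isA col) → InClassT n m T → Statement2 n m T col
  InClassT⇒2 |B|≤|A| (iso-T , iso-T-e) x x∈B = integral⇒2
    (1⇒2 (λ S → ⟦⟧≤⇒ (iso-T S))
         (λ u v e → let S , lt = iso-T-e u v e in S , ⟦⟧>⇒ lt)
         (ℤ.+≤+ |B|≤|A|) x x∈B)

  2⇒3ℤ : 0 ℕ.< count (isB col) → Statement2 n m T col → Statement3ℤ
  2⇒3ℤ 0<|B| st2 = 2⇒3 (B-inhabited 0<|B|) (2⇒integral st2)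

  2⇒InClassT : 0 ℕ.< count (isB col) → Statement2 n m T col → InClassT n m T
  2⇒InClassT 0<|B| st2 =
      (λ S → ⟦⟧≤⇐ (2⇒iso-T (2⇒integral st2 _ (proj₂ (B-inhabited 0<|B|))) S))
    , (λ x y e → let S , lt = 3⇒iso-T-e (2⇒3ℤ 0<|B| st2) x y e in S , ⟦⟧>⇐ lt)

  3⇒2ℚ : count (isB col) ℕ.≤ count (isA col) → Statement3 n m T col → Statement2 n m T col
  3⇒2ℚ |B|≤|A| st3 x x∈B = integral⇒2 (3⇒2 (ℤ.+≤+ |B|≤|A|) (3⇒integral st3) x x∈B)

open import Data.Nat using (_<_; _≤_)

theorem4p1 : (n m : ℕ) → 0 < m → m < n →
    (N : ℕ) (T : Graph N) → Tree T →
    (col : Fin N → Bool) → Bipartition T col →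
    0 < count (isB col) → count (isB col) ≤ count (isA col) →
    (InClassT n m T ⇔ Statement2 n m T col)
    × (Statement2 n m T col ⇔ Statement3 n m T col)
theorem4p1 n (suc m-1) _ m<n N T T-tree col bip 0<|B| |B|≤|A| =
    mk⇔ (InClassT⇒2 |B|≤|A|) (2⇒InClassT 0<|B|)
  , mk⇔ (integral⇒3 ∘ 2⇒3ℤ 0<|B|) (3⇒2ℚ |B|≤|A|)
  where open Transfer n m-1 m<n T T-tree col bip
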